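{- Let $m\ge n$ be positive integers and let $G$ be a non-chordal finite simple graph that does not contain $I_m\vee K_n$ as a subgraph and satisfies $\omega(G[\Omega(G)])+i(G)\le m$. Then there is a chordal completion $G^*$ of $G$ (a chordal spanning supergraph of $G$) with $\omega(G^*)<m+n$.
   Context: $I_m$ is the edgeless graph on $m$ vertices, and $G_1\vee G_2$ is the join (disjoint union plus all edges between $V(G_1)$ and $V(G_2)$). A hole is an induced cycle of length at least $4$; a graph is chordal if it has no hole. $\Omega(G)$ is the set of vertices of $G$ lying on at least one hole, and $G[\Omega(G)]$ the induced subgraph. A nonempty set $X\subseteq V(G)$ is a hole cover of $G$ if every hole of $G$ contains a vertex of $X$ (for chordal $G$ any nonempty set is a hole cover). A vertex $u$ satisfies the NC property in $G$ if no hole of $G$ containing $u$ and hole of $G$ not containing $u$ share two consecutive edges; a set $\mathcal{C}$ satisfies the NC property in $G$ if each of its vertices does and every hole of $G$ contains at most one vertex of $\mathcal{C}$. Locally chordalizing a hole $H$ by a vertex $u$ on $H$ means adding an edge $uv$ for every vertex $v$ of $H$ not adjacent to $u$. For a hole cover $\mathcal{D}=\{u_1,\ldots,u_p\}$ of a graph $F$ satisfying the NC property in $F$, $\widehat{F}(\mathcal{D})$ is obtained from $F_0=F$ by letting $F_i$ be obtained from $F_{i-1}$ by locally chordalizing simultaneously all holes of $F_{i-1}$ containing $u_i$ by $u_i$, and taking $F_p$ (independent of ordering). An ordered partition $(\mathcal{C}_1,\ldots,\mathcal{C}_k)$ of a hole cover $\mathcal{C}$ of $G$ is a local chordalization partition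 if, setting $G_0=G_0^*=G-\mathcal{C}$ and for $i=1,\ldots,k$ letting $V(G_i)=V(G_{i-1}^*)\cup\mathcal{C}_i$, $E(G_i)=E(G_{i-1}^*)\cup E(G-\bigcup_{j=i+1}^k\mathcal{C}_j)$, $G_i^*=\widehat{G_i}(\mathcal{C}_i)$, each $\mathcal{C}_i$ is a hole cover of $G_i$ satisfying the NC property in $G_i$ and each $G_i^*$ is chordal. The non-chordality index $i(G)$ is $0$ if $G$ is chordal, and otherwise the smallest $k$ such that some hole cover of $G$ has a local chordalization partition into $k$ parts. $\omega$ denotes clique number. -}

module Defs where

open import Data.Nat using (ℕ; zero; suc; _+_; _≤_; _<_)
open import Data.Nat.Properties using () renaming (_≟_ to _≟ℕ_)
open import Data.Fin using (Fin; toℕ; splitAt)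
open import Data.Maybe using (Maybe; just; nothing)
open import Data.Bool using (Bool; true; false)
open import Data.List using (List; foldl; allFin)
open import Data.Product using (Σ; Σ-syntax; ∃; ∃-syntax; _×_; _,_; proj₁; proj₂)
open import Data.Sum using (_⊎_; inj₁; inj₂)
open import Data.Empty using (⊥)
open import Data.Unit using (⊤; tt)
open import Function.Definitions using (Injective)
open import Relation.Nullary using (¬_)
open import Relation.Nullary.Decidable using (⌊_⌋)
open import Relation.Binary.PropositionalEquality using (_≡_; _≢_; refl; sym)

record Graph (N : ℕ) : Set₁ where
  field
    Adj    : Fin N → Fin N → Set
    adj-sym : ∀ {x y} → Adj x y → Adj y x
    irrefl : ∀ x → ¬ Adj x x
open Graph public

Edgeless : (m : ℕ) → Graph m
Edgeless m = record { Adj = λ _ _ → ⊥ ; adj-sym = λ () ; irrefl = λ _ () }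

Complete : (n : ℕ) → Graph n
Complete n = record { Adj = λ i j → i ≢ j
                    ; adj-sym = λ i≢j j≡i → i≢j (sym j≡i)
                    ; irrefl = λ x x≢x → x≢x refl }

module _ {a b : ℕ} (A : Graph a) (B : Graph b) where
  JAdj : Fin a ⊎ Fin b → Fin a ⊎ Fin b → Set
  JAdj (inj₁ i) (inj₁ j) = Adj A i j
  JAdj (inj₂ i) (inj₂ j) = Adj B i j
  JAdj (inj₁ _) (inj₂ _) = ⊤
  JAdj (inj₂ _) (inj₁ _) = ⊤

  JAdj-sym : ∀ s t → JAdj s t → JAdj t s
  JAdj-sym (inj₁ i) (inj₁ j) e = Graph.adj-sym A e
  JAdj-sym (inj₂ i) (inj₂ j) e = Graph.adj-sym B e
  JAdj-sym (inj₁ _) (inj₂ _) _ = tt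
  JAdj-sym (inj₂ _) (inj₁ _) _ = tt

  JAdj-irrefl : ∀ s → ¬ JAdj s s
  JAdj-irrefl (inj₁ i) = irrefl A i
  JAdj-irrefl (inj₂ i) = irrefl B i

  Join : Graph (a + b)
  Join = record { Adj = λ x y → JAdj (splitAt a x) (splitAt a y)
                ; adj-sym = λ {x} {y} → JAdj-sym (splitAt a x) (splitAt a y)
                ; irrefl = λ x → JAdj-irrefl (splitAt a x) }

ContainsSubgraph : ∀ {a N} → Graph a → Graph N → Set
ContainsSubgraph {a} {N} H G =
  Σ[ f ∈ (Fin a → Fin N) ] Injective _≡_ _≡_ f × (∀ i j → Adj H i j → Adj G (f i) (f j))

Supergraph : ∀ {N} → Graph N → Graph N → Set
Supergraph G G* = ∀ x y → Adj G x y → Adj G* x y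

Next : ∀ {k} → Fin k → Fin k → Set
Next {k} i j = (suc (toℕ i) ≡ toℕ j) ⊎ (suc (toℕ i) ≡ k × toℕ j ≡ 0)

CycAdj : ∀ {k} → Fin k → Fin k → Set
CycAdj i j = Next i j ⊎ Next j i

record Hole {N : ℕ} (G : Graph N) : Set where
  field
    len     : ℕ
    len≥4   : 4 ≤ len
    cyc     : Fin len → Fin N
    cyc-inj : Injective _≡_ _≡_ cyc
    induced : ∀ i j → (Adj G (cyc i) (cyc j) → CycAdj i j) × (CycAdj i j → Adj G (cyc i) (cyc j))
open Hole public

_∈H_ : ∀ {N} {G : Graph N} → Fin N → Hole G → Set
v ∈H H = ∃[ i ] cyc H i ≡ v

EdgeOf : ∀ {N} {G : Graph N} → Hole G → Fin N → Fin N → Set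
EdgeOf H x y = ∃[ i ] ∃[ j ] CycAdj i j × cyc H i ≡ x × cyc H j ≡ y

ShareTwoConsecutiveEdges : ∀ {N} {G : Graph N} → Hole G → Hole G → Set
ShareTwoConsecutiveEdges {N} H₁ H₂ =
  Σ[ a ∈ Fin N ] Σ[ b ∈ Fin N ] Σ[ c ∈ Fin N ]
    a ≢ c × EdgeOf H₁ a b × EdgeOf H₁ b c × EdgeOf H₂ a b × EdgeOf H₂ b c

Chordal : ∀ {N} → Graph N → Set
Chordal G = ¬ Hole G

InΩ : ∀ {N} → Graph N → Fin N → Set
InΩ G v = Σ[ H ∈ Hole G ] v ∈H H

HoleCover : ∀ {N} → Graph N → (Fin N → Set) → Set
HoleCover G X = (∃[ v ] X v) × (∀ (H : Hole G) → ∃[ v ] (X v × v ∈H H))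

NCVertex : ∀ {N} → Graph N → Fin N → Set
NCVertex G u = ∀ (H₁ H₂ : Hole G) → u ∈H H₁ → ¬ (u ∈H H₂) → ¬ ShareTwoConsecutiveEdges H₁ H₂

NCSet : ∀ {N} → Graph N → (Fin N → Set) → Set
NCSet G X = (∀ u → X u → NCVertex G u)
          × (∀ (H : Hole G) a b → X a → X b → a ∈H H → b ∈H H → a ≡ b)

OnHoleWith : ∀ {N} → Graph N → Fin N → Fin N → Set
OnHoleWith F u v = Σ[ H ∈ Hole F ] (u ∈H H × v ∈H H)

-- If b = true: locally chordalize simultaneously all holes of F containing u by u.
-- If b = false: F unchanged (up to the adjacency relation).
localStep : ∀ {N} → Graph N → Bool → Fin N → Graph N
localStep {N} F b u = record { Adj = A ; adj-sym = s ; irrefl = ir }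
  where
  A : Fin N → Fin N → Set
  A x y = Adj F x y ⊎ (b ≡ true × x ≢ y × ((x ≡ u × OnHoleWith F u y) ⊎ (y ≡ u × OnHoleWith F u x)))
  s : ∀ {x y} → A x y → A y x
  s (inj₁ e) = inj₁ (Graph.adj-sym F e)
  s (inj₂ (bt , x≢y , inj₁ p)) = inj₂ (bt , (λ e → x≢y (sym e)) , inj₂ p)
  s (inj₂ (bt , x≢y , inj₂ p)) = inj₂ (bt , (λ e → x≢y (sym e)) , inj₁ p)
  ir : ∀ x → ¬ A x x
  ir x (inj₁ e) = irrefl F x e
  ir x (inj₂ (_ , x≢x , _)) = x≢x refl

hat : ∀ {N} → Graph N → (Fin N → Bool) → Graph N
hat {N} F D = foldl (λ H u → localStep H (D u) u) F (allFin N)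

-- induced subgraph on P (vertices outside P become isolated)
restrict : ∀ {N} → Graph N → (Fin N → Set) → Graph N
restrict G P = record { Adj = λ x y → P x × P y × Adj G x y
                      ; adj-sym = λ (px , py , e) → py , px , Graph.adj-sym G e
                      ; irrefl = λ x (_ , _ , e) → irrefl G x e }

union : ∀ {N} → Graph N → Graph N → Graph N
union A B = record { Adj = λ x y → Adj A x y ⊎ Adj B x y
                   ; adj-sym = λ { (inj₁ e) → inj₁ (Graph.adj-sym A e) ; (inj₂ e) → inj₂ (Graph.adj-sym B e) }
                   ; irrefl = λ { x (inj₁ e) → irrefl A x e ; x (inj₂ e) → irrefl B x e } }

-- A hole cover C together with an ordered partition (C_1,…,C_k) of it is encoded by
-- p : Fin N → Maybe (Fin k):  v ∈ C_{t+1}  iff  p v ≡ just t  (t : Fin k, toℕ t = 0,…,k-1).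
module LCP {N k : ℕ} (G : Graph N) (p : Fin N → Maybe (Fin k)) where

  InC : Fin N → Set
  InC v = ∃[ t ] p v ≡ just t

  -- v ∈ V(G) ∖ ⋃_{j > i} C_j   (parts numbered 1..k)
  Active : ℕ → Fin N → Set
  Active i v = (p v ≡ nothing) ⊎ (∃[ t ] (p v ≡ just t × toℕ t < i))

  memb : ℕ → Fin N → Bool
  memb i v with p v
  ... | nothing = false
  ... | just t  = ⌊ toℕ t ≟ℕ i ⌋

  Gstar : ℕ → Graph N
  Gstar zero    = restrict G (Active 0)
  Gstar (suc i) = hat (union (Gstar i) (restrict G (Active (suc i)))) (memb i)

  Gi : ℕ → Graph N
  Gi zero    = restrict G (Active 0)
  Gi (suc i) = union (Gstar i) (restrict G (Active (suc i)))

  IsLCP : Set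
  IsLCP = HoleCover G InC
        × (∀ (t : Fin k) →
             HoleCover (Gi (suc (toℕ t))) (λ v → p v ≡ just t)
           × NCSet (Gi (suc (toℕ t))) (λ v → p v ≡ just t)
           × Chordal (Gstar (suc (toℕ t))))

HasLCP : ∀ {N} → Graph N → ℕ → Set
HasLCP {N} G k = Σ[ p ∈ (Fin N → Maybe (Fin k)) ] LCP.IsLCP G p

IsNonChordalityIndex : ∀ {N} → Graph N → ℕ → Set
IsNonChordalityIndex G k =
    (Chordal G × k ≡ 0)
  ⊎ (¬ Chordal G × HasLCP G k × (∀ k′ → HasLCP G k′ → k ≤ k′))

HasCliqueIn : ∀ {N} → Graph N → (Fin N → Set) → ℕ → Set
HasCliqueIn {N} G P s =
  Σ[ f ∈ (Fin s → Fin N) ] Injective _≡_ _≡_ f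
    × (∀ i → P (f i)) × (∀ i j → i ≢ j → Adj G (f i) (f j))

HasClique : ∀ {N} → Graph N → ℕ → Set
HasClique G s = HasCliqueIn G (λ _ → ⊤) s

IsCliqueNumberOn : ∀ {N} → Graph N → (Fin N → Set) → ℕ → Set
IsCliqueNumberOn G P w = HasCliqueIn G P w × (∀ s → HasCliqueIn G P s → s ≤ w)

{-# OPTIONS --safe #-}
module Submission where


-- G* is the graph G_k* produced by a shortest local chordalization partition.
-- (1) A vertex x of F lies on a hole as soon as two nonadjacent neighbours of x are joined by a walk that
--     otherwise avoids the closed neighbourhood of x: a shortest such walk closes up at x.
-- (2) Hence chordalizing by a vertex with the NC property creates no hole, so every edge added in step i joins a
--     vertex of C_i to another vertex of a hole of G_i; and adding chords of holes puts no new vertex on a hole,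
--     so both ends of every added edge lie in Ω(G).
-- (3) Two disjoint added edges u₁v₁, u₂v₂ of one step inside a clique would put u₁ and u₂ on a common hole. So
--     those inside a clique form a star, and each step raises the clique number by at most one.
-- (4) Let K be a clique of G* with m + n vertices. If n of them lie outside Ω(G), these are joined in G to all
--     of K, which gives I_m ∨ K_n. Otherwise more than m ≥ ω(G[Ω(G)]) + k vertices of K lie in Ω(G), and undoing
--     the k steps leaves a clique of G[Ω(G)] with more than ω(G[Ω(G)]) vertices.
-- Adjacency is undecidable, so the arguments about holes run under double negation.

open import Defs
open import Data.Bool using (Bool; true)
open import Data.Nat using (ℕ; zero; suc; _+_; _∸_; _≤_; _<_; z≤n; s≤s; _<?_)
open import Data.Nat.Properties
  using (≤-refl; ≤-trans; <-trans; <-≤-trans; ≤-<-trans; <-irrefl; n≤1+n; ≤∧≢⇒<; suc-injective; +-suc; +-identityʳ;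
         m≤m+n; m+[n∸m]≡n; ≮⇒≥; ≤-antisym; <⇒≤; ≤-reflexive; ≤-pred; ≰⇒>; +-comm; +-assoc; +-cancelʳ-≤;
         +-monoʳ-≤; m≤n⇒∃[o]m+o≡n)
  renaming (_≟_ to _≟ℕ_)
open import Data.Fin
  using (Fin; zero; suc; toℕ; fromℕ; fromℕ<; inject₁; punchIn; inject≤; splitAt; join; _↑ˡ_; _↑ʳ_)
open import Data.Fin.Properties
  using (toℕ-injective; toℕ<n; toℕ-fromℕ<; toℕ-fromℕ; toℕ-inject₁; punchInᵢ≢i; punchIn-injective;
         inject≤-injective; join-splitAt; splitAt-↑ˡ; splitAt-↑ʳ; ↑ˡ-injective; ↑ʳ-injective)
  renaming (_≟_ to _≟F_; suc-injective to Fin-suc-injective)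
open import Data.List using (List; []; _∷_; length; lookup; foldl; allFin)
open import Data.List.Membership.Propositional.Properties using (∈-lookup)
open import Data.List.Relation.Unary.All using (All; []; _∷_)
import Data.List.Relation.Unary.All as All
open import Data.List.Relation.Unary.All.Properties using (¬Any⇒All¬)
open import Data.List.Relation.Unary.Any using (Any; here; there)
open import Data.Maybe using (Maybe; just; nothing)
open import Data.Product using (Σ-syntax; ∃; ∃-syntax; _×_; _,_; proj₁; proj₂)
open import Data.Sum using (_⊎_; inj₁; inj₂; [_,_]; swap)
open import Data.Empty using (⊥; ⊥-elim)
open import Function using (_∘_; id)
open import Function.Definitions using (Injective)
open import Relation.Nullary using (¬_; Dec; yes; no)
open import Relation.Nullary.Decidable using (¬¬-excluded-middle)
open import Relation.Binary.PropositionalEquality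
  using (_≡_; _≢_; refl; sym; trans; cong; subst; subst₂)

private variable
  N k : ℕ

-- Walks through a prescribed set of vertices

Touch : Graph N → Fin N → Fin N → Set
Touch F x y = x ≡ y ⊎ Adj F x y

-- `P` holds at every vertex, both ends included. It records the set that the walk runs through, and
-- the arguments below compare such sets instead of lists of vertices.
data Walk (F : Graph N) (P : Fin N → Set) : Fin N → Fin N → Set where
  stay : ∀ {x} → P x → Walk F P x x
  step : ∀ {x y z} → P x → Adj F x y → Walk F P y z → Walk F P x z

module _ {F : Graph N} where

  start∈ : ∀ {P x y} → Walk F P x y → P x
  start∈ (stay p) = p
  start∈ (step p _ _) = p

  infixr 5 _++ʷ_
  _++ʷ_ : ∀ {P x y z} → Walk F P x y → Walk F P y z → Walk F P x z
  stay _ ++ʷ w = w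
  step p e v ++ʷ w = step p e (v ++ʷ w)

  reverseʷ : ∀ {P x y} → Walk F P x y → Walk F P y x
  reverseʷ (stay p) = stay p
  reverseʷ (step p e w) = reverseʷ w ++ʷ step (start∈ w) (adj-sym F e) (stay p)

  touch-sym : ∀ {x y} → Touch F x y → Touch F y x
  touch-sym (inj₁ e) = inj₁ (sym e)
  touch-sym (inj₂ e) = inj₂ (adj-sym F e)

  touchWalk : ∀ {P : Fin N → Set} {x y} → P x → P y → Touch F x y → Walk F P x y
  touchWalk px py (inj₁ refl) = stay px
  touchWalk px py (inj₂ e) = step px e (stay py)

  -- The walk has to leave `S` somewhere, and the step on which it does so is an edge into `T`.
  crossing : ∀ {S T : Fin N → Set} {x y} → Walk F (λ a → S a ⊎ T a) x y → S x → T y →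
             ¬ (∀ s t → S s → T t → ¬ Touch F s t)
  crossing (stay _) s t apart = apart _ _ s t (inj₁ refl)
  crossing (step _ e w) s t apart with start∈ w
  ... | inj₁ s′ = crossing w s′ t apart
  ... | inj₂ t′ = apart _ _ s t′ (inj₂ e)

mapʷ : ∀ {F F′ : Graph N} {P Q : Fin N → Set} → (∀ {a} → P a → Q a) →
       (∀ {a b} → P a → P b → Adj F a b → Adj F′ a b) →
       ∀ {x y} → Walk F P x y → Walk F′ Q x y
mapʷ f g (stay p) = stay (f p)
mapʷ f g (step p e w) = step (f p) (g p (start∈ w) e) (mapʷ f g w)

weaken : ∀ {F : Graph N} {P Q : Fin N → Set} → (∀ {a} → P a → Q a) →
         ∀ {x y} → Walk F P x y → Walk F Q x y
weaken f = mapʷ f (λ _ _ e → e)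

-- The walk is cut at its first vertex in `Q`, which is why only the new end can satisfy `Q`.
firstHit : ∀ {F : Graph N} {P Q : Fin N → Set} {x y} → Walk F P x y → Q y →
           ¬ ¬ (∃[ c ] P c × Q c × Walk F (λ a → P a × (Q a → a ≡ c)) x c)
firstHit (stay p) q κ = κ (_ , p , q , stay (p , (λ _ → refl)))
firstHit {x = x} (step p e w) q κ = ¬¬-excluded-middle λ where
  (yes qx) → κ (x , p , qx , stay (p , (λ _ → refl)))
  (no ¬qx) → firstHit w q λ (c , pc , qc , w′) →
    κ (c , pc , qc , step (p , ⊥-elim ∘ ¬qx) e w′)

-- Induced paths, and holes obtained by closing them

-- The first vertex is kept apart from the list of the later ones. In `cons` the list `l` starts
-- after the successor `y`, so `x` is adjacent to `y` and touches nothing further on.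
data Induced (F : Graph N) : Fin N → List (Fin N) → Set where
  single : ∀ {x} → Induced F x []
  cons   : ∀ {x y l} → Adj F x y → All (λ a → ¬ Touch F x a) l → Induced F y l →
           Induced F x (y ∷ l)

end : Fin N → List (Fin N) → Fin N
end x [] = x
end x (y ∷ l) = end y l

lookup-end : ∀ (x : Fin N) l → lookup (x ∷ l) (fromℕ (length l)) ≡ end x l
lookup-end x [] = refl
lookup-end x (y ∷ l) = lookup-end y l

module _ {F : Graph N} where

  -- The new vertex `x` is linked to the last vertex of the path that it touches, and everything
  -- before that vertex is dropped. If that vertex is `x` itself, the remaining suffix already
  -- starts at `x`.
  attach : ∀ {P : Fin N → Set} {x} h t → Induced F h t → P x → All P (h ∷ t) → Any (Touch F x) (h ∷ t) →
           ¬ ¬ (∃[ l ] Induced F x l × end x l ≡ end h t × All P (x ∷ l))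
  attach h t i px ps (there a) κ with t | i | ps
  ... | h′ ∷ t′ | cons _ _ i′ | _ ∷ ps′ = attach h′ t′ i′ px ps′ a κ
  attach {x = x} h [] i px ps (here (inj₁ refl)) κ = κ ([] , single , refl , ps)
  attach {x = x} h [] i px ps (here (inj₂ e)) κ = κ (h ∷ [] , cons e [] i , refl , px ∷ ps)
  attach {x = x} h (h′ ∷ t′) i@(cons _ _ i′) px ps@(_ ∷ ps′) (here th) κ = ¬¬-excluded-middle λ where
    (yes a) → attach h′ t′ i′ px ps′ a κ
    (no ¬a) → [ (λ { refl → κ (h′ ∷ t′ , i , refl , ps) })
              , (λ e → κ (h ∷ h′ ∷ t′ , cons e (¬Any⇒All¬ _ ¬a) i , refl , px ∷ ps)) ] th

  shorten : ∀ {P : Fin N → Set} {x z} → Walk F P x z →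
            ¬ ¬ (∃[ l ] Induced F x l × end x l ≡ z × All P (x ∷ l))
  shorten (stay p) κ = κ ([] , single , refl , p ∷ [])
  shorten (step p e w) κ = shorten w λ (l , i , q , ps) →
    attach _ l i p ps (here (inj₂ e)) λ (l′ , i′ , q′ , ps′) → κ (l′ , i′ , trans q′ q , ps′)

  toWalk : ∀ {P : Fin N → Set} {x} l → Induced F x l → (∀ i → P (lookup (x ∷ l) i)) → Walk F P x (end x l)
  toWalk [] single p = stay (p zero)
  toWalk (y ∷ l) (cons e _ i) p = step (p zero) e (toWalk l i (p ∘ suc))

  lookup-apart : ∀ {x y l} → Induced F x (y ∷ l) → ∀ i → ¬ Touch F x (lookup l i)
  lookup-apart (cons _ ¬t _) i t = All.lookup ¬t (∈-lookup i) t

  lookup-inj : ∀ {x} l → Induced F x l → Injective _≡_ _≡_ (lookup (x ∷ l))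
  lookup-inj l i {zero} {zero} e = refl
  lookup-inj (y ∷ l) (cons a _ i) {zero} {suc zero} refl = ⊥-elim (irrefl F _ a)
  lookup-inj (y ∷ l) i {zero} {suc (suc t)} e = ⊥-elim (lookup-apart i t (inj₁ e))
  lookup-inj (y ∷ l) (cons a _ i) {suc zero} {zero} refl = ⊥-elim (irrefl F _ a)
  lookup-inj (y ∷ l) i {suc (suc s)} {zero} e = ⊥-elim (lookup-apart i s (inj₁ (sym e)))
  lookup-inj (y ∷ l) (cons _ _ i) {suc s} {suc t} e = cong suc (lookup-inj l i e)

  induced⇒consecutive : ∀ {x} l → Induced F x l → ∀ s t → Adj F (lookup (x ∷ l) s) (lookup (x ∷ l) t) →
                        suc (toℕ s) ≡ toℕ t ⊎ suc (toℕ t) ≡ toℕ s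
  induced⇒consecutive l i zero zero a = ⊥-elim (irrefl F _ a)
  induced⇒consecutive (y ∷ l) i zero (suc zero) a = inj₁ refl
  induced⇒consecutive (y ∷ l) i zero (suc (suc t)) a = ⊥-elim (lookup-apart i t (inj₂ a))
  induced⇒consecutive (y ∷ l) i (suc zero) zero a = inj₂ refl
  induced⇒consecutive (y ∷ l) i (suc (suc s)) zero a = ⊥-elim (lookup-apart i s (inj₂ (adj-sym F a)))
  induced⇒consecutive (y ∷ l) (cons _ _ i) (suc s) (suc t) a with induced⇒consecutive l i s t a
  ... | inj₁ e = inj₁ (cong suc e)
  ... | inj₂ e = inj₂ (cong suc e)

  consecutive⇒adj : ∀ {x} l → Induced F x l → ∀ s t → suc (toℕ s) ≡ toℕ t →
                    Adj F (lookup (x ∷ l) s) (lookup (x ∷ l) t)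
  consecutive⇒adj (y ∷ l) (cons a _ _) zero (suc zero) e = a
  consecutive⇒adj (y ∷ l) (cons _ _ i) (suc s) (suc t) e = consecutive⇒adj l i s t (suc-injective e)

  -- An induced path extracted from the walk meets the neighbourhood of `x` only in its two ends, so
  -- adding `x` gives an induced cycle; its length is at least 4 because `y` and `z` do not touch.
  -- The walk handed back shows which part of `P` the hole uses.
  closeUp : ∀ {P : Fin N → Set} {x y z} → Adj F x y → Adj F x z → ¬ Touch F y z →
            (∀ {a} → P a → a ≢ x × (Adj F x a → a ≡ y ⊎ a ≡ z)) → Walk F P y z →
            ¬ ¬ (Σ[ K ∈ Hole F ] x ∈H K × (∀ {a} → a ∈H K → a ≡ x ⊎ P a) × Walk F (λ a → P a × a ∈H K) y z)
  closeUp {P} {x} {y} {z} xy xz ¬yz only w κ = shorten w λ (l , i , q , ps) → finish l i q ps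
    where
    finish : ∀ l → Induced F y l → end y l ≡ z → All P (y ∷ l) → ⊥
    finish l i refl ps = κ (K , (zero , refl)
                             , (λ { (zero , refl) → inj₁ refl ; (suc t , refl) → inj₂ (at t) })
                             , toWalk l i (λ t → at t , suc t , refl))
      where
      at : ∀ t → P (lookup (y ∷ l) t)
      at t = All.lookup ps (∈-lookup t)
      len≥ : ∀ l → Induced F y l → ¬ Touch F y (end y l) → 4 ≤ suc (suc (length l))
      len≥ [] i ¬t = ⊥-elim (¬t (inj₁ refl))
      len≥ (_ ∷ []) (cons e _ _) ¬t = ⊥-elim (¬t (inj₂ e))
      len≥ (_ ∷ _ ∷ _) i ¬t = s≤s (s≤s (s≤s (s≤s z≤n)))
      c : Fin (suc (suc (length l))) → Fin N
      c = lookup (x ∷ y ∷ l)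
      x-adj⇒ : ∀ t → Adj F x (lookup (y ∷ l) t) → CycAdj {suc (suc (length l))} zero (suc t)
      x-adj⇒ t a with proj₂ (only (at t)) a
      ... | inj₁ e with refl ← lookup-inj l i {t} {zero} e = inj₁ (inj₁ refl)
      -- `z` ends the path, so injectivity forces the last index, the one that wraps around to `x`
      -- at index 0.
      ... | inj₂ e with refl ← lookup-inj l i {t} {fromℕ (length l)} (trans e (sym (lookup-end y l))) =
        inj₂ (inj₂ (cong (λ m → suc (suc m)) (toℕ-fromℕ _) , refl))
      x-adj⇐ : ∀ t → CycAdj {suc (suc (length l))} zero (suc t) → Adj F x (lookup (y ∷ l) t)
      x-adj⇐ zero _ = xy
      x-adj⇐ (suc t) (inj₁ (inj₁ ()))
      x-adj⇐ (suc t) (inj₁ (inj₂ (() , _)))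
      x-adj⇐ (suc t) (inj₂ (inj₁ ()))
      x-adj⇐ (suc t) (inj₂ (inj₂ (e , _))) =
        subst (λ v → Adj F x (lookup (y ∷ l) v))
              (toℕ-injective (trans (toℕ-fromℕ _) (sym (suc-injective (suc-injective e)))))
              (subst (Adj F x) (sym (lookup-end y l)) xz)
      ind : ∀ s t → (Adj F (c s) (c t) → CycAdj s t) × (CycAdj s t → Adj F (c s) (c t))
      ind zero zero = ⊥-elim ∘ irrefl F x
                    , λ { (inj₁ (inj₁ ())) ; (inj₁ (inj₂ (() , _))) ; (inj₂ (inj₁ ())) ; (inj₂ (inj₂ (() , _))) }
      ind zero (suc t) = x-adj⇒ t , x-adj⇐ t
      ind (suc s) zero = swap ∘ x-adj⇒ s ∘ adj-sym F , adj-sym F ∘ x-adj⇐ s ∘ swap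
      ind (suc s) (suc t) = (λ a → [ (λ e → inj₁ (inj₁ (cong suc e))) , (λ e → inj₂ (inj₁ (cong suc e))) ]
                                     (induced⇒consecutive l i s t a))
                          , λ { (inj₁ (inj₁ e)) → consecutive⇒adj l i s t (suc-injective e)
                              ; (inj₂ (inj₁ e)) → adj-sym F (consecutive⇒adj l i t s (suc-injective e)) 
                              ; (inj₁ (inj₂ (_ , ()))) ; (inj₂ (inj₂ (_ , ()))) }
      inj : Injective _≡_ _≡_ c
      inj {zero} {zero} e = refl
      inj {zero} {suc t} e = ⊥-elim (proj₁ (only (at t)) (sym e))
      inj {suc s} {zero} e = ⊥-elim (proj₁ (only (at s)) e)
      inj {suc s} {suc t} e = cong suc (lookup-inj l i e)
      K : Hole F
      K = record { len = suc (suc (length l)) ; len≥4 = len≥ l i ¬yz ; cyc = c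
                 ; cyc-inj = inj ; induced = ind }

-- Rotating holes, and reading off their arcs

Next-functional : ∀ {i j j′ : Fin k} → Next i j → Next i j′ → j ≡ j′
Next-functional (inj₁ p) (inj₁ q) = toℕ-injective (trans (sym p) q)
Next-functional {j = j} (inj₁ p) (inj₂ (q , _)) = ⊥-elim (<-irrefl (trans (sym p) q) (toℕ<n j))
Next-functional {j′ = j} (inj₂ (p , _)) (inj₁ q) = ⊥-elim (<-irrefl (trans (sym q) p) (toℕ<n j))
Next-functional (inj₂ (_ , p)) (inj₂ (_ , q)) = toℕ-injective (trans p (sym q))

Next-cofunctional : ∀ {i i′ j : Fin k} → Next i j → Next i′ j → i ≡ i′
Next-cofunctional (inj₁ p) (inj₁ q) = toℕ-injective (suc-injective (trans p (sym q)))
Next-cofunctional (inj₁ p) (inj₂ (_ , q)) with () ← trans p q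
Next-cofunctional (inj₂ (_ , p)) (inj₁ q) with () ← trans q p
Next-cofunctional (inj₂ (p , _)) (inj₂ (q , _)) = toℕ-injective (suc-injective (trans p (sym q)))

next : (i : Fin k) → ∃ (Next i)
next {k} i with suc (toℕ i) <? k
... | yes p = fromℕ< p , inj₁ (sym (toℕ-fromℕ< p))
... | no ¬p = fromℕ< 0<k , inj₂ (≤-antisym (toℕ<n i) (≮⇒≥ ¬p) , toℕ-fromℕ< 0<k)
  where 0<k = ≤-<-trans z≤n (toℕ<n i)

prev : (j : Fin k) → ∃[ i ] Next i j
prev {suc k} zero = fromℕ k , inj₂ (cong suc (toℕ-fromℕ k) , refl)
prev {suc k} (suc j) = inject₁ j , inj₁ (cong suc (toℕ-inject₁ j))

module _ {F : Graph N} where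

  rotate : Hole F → Hole F
  rotate H = record
    { len = len H ; len≥4 = len≥4 H ; cyc = λ i → cyc H (nxt i)
    ; cyc-inj = λ {i} {j} e → Next-cofunctional (subst (Next i) (cyc-inj H e) (isNext i)) (isNext j)
    ; induced = λ i j → [ (λ n → inj₁ (back n)) , (λ n → inj₂ (back n)) ] ∘ proj₁ (induced H _ _)
                      , proj₂ (induced H _ _) ∘ [ (λ n → inj₁ (forth n)) , (λ n → inj₂ (forth n)) ] }
    where
    nxt : Fin (len H) → Fin (len H)
    nxt i = proj₁ (next i)
    isNext : ∀ i → Next i (nxt i)
    isNext i = proj₂ (next i)
    forth : ∀ {i j} → Next i j → Next (nxt i) (nxt j)
    forth {i} {j} n = subst (λ v → Next v (nxt j)) (Next-functional n (isNext i)) (isNext j)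
    back : ∀ {i j} → Next (nxt i) (nxt j) → Next i j
    back {i} {j} n = subst (Next i) (Next-cofunctional n (isNext j)) (isNext i)

  ∈-rotate : ∀ {a} H → a ∈H H → a ∈H rotate H
  ∈-rotate H (i , e) = proj₁ (prev i)
    , trans (cong (cyc H) (Next-functional (proj₂ (next (proj₁ (prev i)))) (proj₂ (prev i)))) e

  StartsAt : Hole F → Fin N → Set
  StartsAt H u = ∃[ o ] toℕ o ≡ 0 × cyc H o ≡ u

  -- With `u` at index 0, the arcs of the hole become intervals of indices.
  rotateTo : ∀ {u} (H : Hole F) → u ∈H H →
             Σ[ H′ ∈ Hole F ] StartsAt H′ u × (∀ {a} → a ∈H H → a ∈H H′) × (∀ {a} → a ∈H H′ → a ∈H H)
  rotateTo H (i , refl) = go H (toℕ i) i refl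
    where
    go : ∀ H m i → toℕ i ≡ m →
         Σ[ H′ ∈ Hole F ] StartsAt H′ (cyc H i) × (∀ {a} → a ∈H H → a ∈H H′) × (∀ {a} → a ∈H H′ → a ∈H H)
    go H zero i e = H , (i , e , refl) , id , id
    go H (suc m) i e with prev i
    ... | j , inj₂ (_ , e′) with () ← trans (sym e) e′
    ... | j , n@(inj₁ e′) with go (rotate H) m j (suc-injective (trans e′ e))
    ...   | H′ , s , to , from = H′
          , subst (λ v → StartsAt H′ (cyc H v)) (Next-functional (proj₂ (next j)) n) s
          , to ∘ ∈-rotate H , (λ (i , e) → proj₁ (next i) , e) ∘ from

  module _ (H : Hole F) where

    segment : ∀ (i j : Fin (len H)) → toℕ i ≤ toℕ j →
              Walk F (λ a → ∃[ t ] toℕ i ≤ toℕ t × toℕ t ≤ toℕ j × cyc H t ≡ a) (cyc H i) (cyc H j)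
    segment i j i≤j = go (toℕ j ∸ toℕ i) i (m+[n∸m]≡n i≤j)
      where
      go : ∀ d i → toℕ i + d ≡ toℕ j →
           Walk F (λ a → ∃[ t ] toℕ i ≤ toℕ t × toℕ t ≤ toℕ j × cyc H t ≡ a) (cyc H i) (cyc H j)
      go zero i e with refl ← toℕ-injective (trans (sym (+-identityʳ _)) e) = stay (i , ≤-refl , ≤-refl , refl)
      go (suc d) i e = step (i , ≤-refl , subst (toℕ i ≤_) e (m≤m+n _ _) , refl)
                            (proj₂ (induced H i i′) (inj₁ (inj₁ (sym i′≡))))
                            (weaken (λ (t , p , q) → t , ≤-trans (n≤1+n _) (subst (_≤ toℕ t) i′≡ p) , q)
                                    (go d i′ (trans (cong (_+ d) i′≡) e′)))
        where
        e′ : suc (toℕ i) + d ≡ toℕ j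
        e′ = trans (sym (+-suc _ d)) e
        i+1<k : suc (toℕ i) < len H
        i+1<k = ≤-<-trans (subst (suc (toℕ i) ≤_) e′ (m≤m+n _ d)) (toℕ<n j)
        i′ : Fin (len H)
        i′ = fromℕ< i+1<k
        i′≡ : toℕ i′ ≡ suc (toℕ i)
        i′≡ = toℕ-fromℕ< i+1<k

  -- The data that `closeUp` turns into a hole, read off from a given hole: the two neighbours of
  -- `x` and the rest of the cycle as a walk between them.
  record Star (H : Hole F) (x : Fin N) : Set where
    field
      left right : Fin N
      left-adj   : Adj F x left
      right-adj  : Adj F x right
      apart      : ¬ Touch F left right
      walk       : Walk F (λ a → a ∈H H × a ≢ x × (Adj F x a → a ≡ left ⊎ a ≡ right)) left right

  -- `A` stands for the interior of one of the two arcs of `H` between `u` and `v`, with `near` its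
  -- end next to `u` and `far` its end next to `v`; these may coincide. Connectedness is stated from
  -- `near`.
  record Arc (H : Hole F) (u v : Fin N) (A : Fin N → Set) : Set where
    field
      near far  : Fin N
      near∈     : A near
      far∈      : A far
      near-adj  : Adj F u near
      far-adj   : Adj F v far
      near-only : ∀ {a} → A a → Adj F u a → a ≡ near
      far-only  : ∀ {a} → A a → Adj F v a → a ≡ far
      u∉        : ∀ {a} → A a → a ≢ u
      v∉        : ∀ {a} → A a → a ≢ v
      on        : ∀ {a} → A a → a ∈H H
      reach     : ∀ {a} → A a → Walk F A near a

  record Arcs (u v : Fin N) : Set₁ where
    field
      distinct : u ≢ v
      hole : Hole F
      u∈   : u ∈H hole
      v∈   : v ∈H hole
      A B  : Fin N → Set
      arcA : Arc hole u v A
      arcB : Arc hole u v B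
      separated : ∀ {a b} → A a → B b → ¬ Touch F a b

  adj⇒edge : ∀ {a b} (H : Hole F) → a ∈H H → b ∈H H → Adj F a b → EdgeOf H a b
  adj⇒edge H (i , refl) (j , refl) e = i , j , proj₁ (induced H i j) e , refl , refl

  module Around (H : Hole F) (o : Fin (len H)) (o≡0 : toℕ o ≡ 0) where

    first last′ : Fin (len H)
    first = proj₁ (next o)
    last′ = proj₁ (prev o)

    first≡1 : toℕ first ≡ 1
    first≡1 with proj₂ (next o)
    ... | inj₁ e = trans (sym e) (cong suc o≡0)
    ... | inj₂ (e , _) with s≤s () ← subst (4 ≤_) (trans (sym e) (cong suc o≡0)) (len≥4 H)

    last≡ : suc (toℕ last′) ≡ len H
    last≡ with proj₂ (prev o)
    ... | inj₁ e with () ← trans e o≡0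
    ... | inj₂ (e , _) = e

    ≤last : ∀ (t : Fin (len H)) → toℕ t ≤ toℕ last′
    ≤last t = ≤-pred (subst (toℕ t <_) (sym last≡) (toℕ<n t))

    adj-first : Adj F (cyc H o) (cyc H first)
    adj-first = proj₂ (induced H _ _) (inj₁ (proj₂ (next o)))

    adj-last : Adj F (cyc H o) (cyc H last′)
    adj-last = proj₂ (induced H _ _) (inj₂ (proj₂ (prev o)))

    adj⇒ : ∀ i t → Adj F (cyc H i) (cyc H t) → t ≡ proj₁ (next i) ⊎ t ≡ proj₁ (prev i)
    adj⇒ i t e with proj₁ (induced H i t) e
    ... | inj₁ n = inj₁ (Next-functional n (proj₂ (next i)))
    ... | inj₂ n = inj₂ (Next-cofunctional n (proj₂ (prev i)))

    -- The indices are 1 and `len H` minus 1. Each way in which they could coincide or be cyclically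
    -- consecutive would make the length less than 4.
    apart′ : ¬ Touch F (cyc H first) (cyc H last′)
    apart′ (inj₁ e) = short (trans (cong suc (sym first≡1)) (trans (cong (suc ∘ toℕ) (cyc-inj H e)) last≡))
      where
      short : 2 ≢ len H
      short e with s≤s (s≤s ()) ← subst (4 ≤_) (sym e) (len≥4 H)
    apart′ (inj₂ e) with proj₁ (induced H _ _) e
    ... | inj₁ (inj₁ e) with s≤s (s≤s (s≤s ())) ←
      subst (4 ≤_) (trans (sym last≡) (cong suc (trans (sym e) (cong suc first≡1)))) (len≥4 H)
    ... | inj₁ (inj₂ (e , _)) with s≤s (s≤s ()) ← subst (4 ≤_) (trans (sym e) (cong suc first≡1)) (len≥4 H)
    ... | inj₂ (inj₁ e) with s≤s () ← subst (4 ≤_) (trans (sym last≡) (trans e first≡1)) (len≥4 H)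
    ... | inj₂ (inj₂ (_ , e)) with () ← trans (sym first≡1) e

    positive : ∀ {t} → 1 ≤ toℕ t → t ≢ o
    positive p refl with () ← subst (1 ≤_) o≡0 p

    module Between (j : Fin (len H)) (j≢o : j ≢ o) (j≢first : j ≢ first) (j≢last : j ≢ last′) where

      after before : Fin (len H)
      after = proj₁ (next j)
      before = proj₁ (prev j)

      after≡ : toℕ after ≡ suc (toℕ j)
      after≡ with proj₂ (next j)
      ... | inj₁ e = sym e
      ... | inj₂ (e , _) = ⊥-elim (j≢last (toℕ-injective (suc-injective (trans e (sym last≡)))))

      before≡ : suc (toℕ before) ≡ toℕ j
      before≡ with proj₂ (prev j)
      ... | inj₁ e = e
      ... | inj₂ (_ , e) = ⊥-elim (j≢o (toℕ-injective (trans e (sym o≡0))))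

      j<after : toℕ j < toℕ after
      j<after = ≤-reflexive (sym after≡)

      before<j : toℕ before < toℕ j
      before<j = ≤-reflexive before≡

      1≤j : 1 ≤ toℕ j
      1≤j = subst (1 ≤_) before≡ (s≤s z≤n)

      first≤before : toℕ first ≤ toℕ before
      first≤before = ≤-pred (subst (suc (toℕ first) ≤_) (sym before≡)
        (≤∧≢⇒< (subst (_≤ toℕ j) (sym first≡1) 1≤j) (λ e → j≢first (toℕ-injective (sym e)))))

      Low High : Fin N → Set
      Low a = ∃[ t ] toℕ first ≤ toℕ t × toℕ t ≤ toℕ before × cyc H t ≡ a
      High a = ∃[ t ] toℕ after ≤ toℕ t × toℕ t ≤ toℕ last′ × cyc H t ≡ a

      lowArc : Arc H (cyc H o) (cyc H j) Low
      lowArc = record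
        { near = cyc H first ; far = cyc H before
        ; near∈ = first , ≤-refl , first≤before , refl
        ; far∈ = before , first≤before , ≤-refl , refl
        ; near-adj = adj-first
        ; far-adj = proj₂ (induced H _ _) (inj₂ (proj₂ (prev j)))
        ; near-only = λ { (t , _ , q , refl) e → cong (cyc H) (near-only′ q (adj⇒ o t e)) }
        ; far-only = λ { (t , _ , q , refl) e → cong (cyc H) (far-only′ q (adj⇒ j t e)) }
        ; u∉ = λ { (t , p , _ , refl) e → positive (subst (_≤ toℕ t) first≡1 p) (cyc-inj H e) }
        ; v∉ = λ { (t , _ , q , refl) e →
                   <-irrefl refl (≤-<-trans (subst (λ v → toℕ v ≤ toℕ before) (cyc-inj H e) q) before<j) }
        ; on = λ (t , _ , _ , e) → t , e
        ; reach = λ { (t , p , q , refl) →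
                      weaken (λ (s , a , b , e) → s , a , ≤-trans b q , e) (segment H first t p) } }
        where
        near-only′ : ∀ {t} → toℕ t ≤ toℕ before → t ≡ first ⊎ t ≡ last′ → t ≡ first
        near-only′ q (inj₁ e) = e
        near-only′ q (inj₂ refl) = ⊥-elim (<-irrefl refl (<-≤-trans before<j (≤-trans (≤last j) q)))
        far-only′ : ∀ {t} → toℕ t ≤ toℕ before → t ≡ after ⊎ t ≡ before → t ≡ before
        far-only′ q (inj₁ refl) = ⊥-elim (<-irrefl refl (<-trans j<after (≤-<-trans q before<j)))
        far-only′ q (inj₂ e) = e

      highArc : Arc H (cyc H o) (cyc H j) High
      highArc = record
        { near = cyc H last′ ; far = cyc H after
        ; near∈ = last′ , ≤last after , ≤-refl , refl
        ; far∈ = after , ≤-refl , ≤last after , refl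
        ; near-adj = adj-last
        ; far-adj = proj₂ (induced H _ _) (inj₁ (proj₂ (next j)))
        ; near-only = λ { (t , p , _ , refl) e → cong (cyc H) (near-only′ p (adj⇒ o t e)) }
        ; far-only = λ { (t , p , _ , refl) e → cong (cyc H) (far-only′ p (adj⇒ j t e)) }
        ; u∉ = λ { (t , p , _ , refl) e → positive (≤-trans 1≤j (≤-trans (<⇒≤ j<after) p)) (cyc-inj H e) }
        ; v∉ = λ { (t , p , _ , refl) e →
                   <-irrefl refl (<-≤-trans j<after (subst (λ v → toℕ after ≤ toℕ v) (cyc-inj H e) p)) }
        ; on = λ (t , _ , _ , e) → t , e
        ; reach = λ { (t , p , q , refl) →
                      reverseʷ (weaken (λ (s , a , b , e) → s , ≤-trans p a , b , e) (segment H t last′ q)) } }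
        where
        near-only′ : ∀ {t} → toℕ after ≤ toℕ t → t ≡ first ⊎ t ≡ last′ → t ≡ last′
        near-only′ p (inj₁ refl) = ⊥-elim (<-irrefl (sym first≡1) (≤-<-trans 1≤j (<-≤-trans j<after p)))
        near-only′ p (inj₂ e) = e
        far-only′ : ∀ {t} → toℕ after ≤ toℕ t → t ≡ after ⊎ t ≡ before → t ≡ after
        far-only′ p (inj₁ e) = e
        far-only′ p (inj₂ refl) = ⊥-elim (<-irrefl refl (<-trans j<after (≤-<-trans p before<j)))

      -- A low index is at least 1 and below `j`, a high index is above `j`. Neither a step by one
      -- nor the wrap from the last index to 0 can join them.
      separated′ : ∀ {a b} → Low a → High b → ¬ Touch F a b
      separated′ (s , p , q , refl) (t , p′ , q′ , refl) =
        [ (λ e → s≮t (subst (λ v → toℕ t ≤ toℕ v) (sym (cyc-inj H e)) ≤-refl))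
        , (λ e → consecutive (proj₁ (induced H s t) e)) ]
        where
        s<j : toℕ s < toℕ j
        s<j = ≤-<-trans q before<j
        j<t : toℕ j < toℕ t
        j<t = <-≤-trans j<after p′
        s≮t : ¬ toℕ t ≤ toℕ s
        s≮t le = <-irrefl refl (<-trans s<j (<-≤-trans j<t le))
        consecutive : ¬ CycAdj s t
        consecutive (inj₁ (inj₁ e)) = <-irrefl refl (<-≤-trans j<t (subst (_≤ toℕ j) e s<j))
        consecutive (inj₁ (inj₂ (e , _))) =
          s≮t (subst (toℕ t ≤_) (suc-injective (trans last≡ (sym e))) (≤last t))
        consecutive (inj₂ (inj₁ e)) = s≮t (subst (toℕ t ≤_) e (n≤1+n _))
        consecutive (inj₂ (inj₂ (_ , e))) with () ← subst (1 ≤_) e (subst (_≤ toℕ s) first≡1 p)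

  star : ∀ {x} (H : Hole F) → x ∈H H → Star H x
  star H x∈ with rotateTo H x∈
  ... | H′ , (o , o≡0 , refl) , _ , from = record
    { left = cyc H′ first ; right = cyc H′ last′ ; left-adj = adj-first ; right-adj = adj-last ; apart = apart′
    ; walk = weaken (λ { (t , p , _ , refl) → from (t , refl)
                                            , positive (subst (_≤ toℕ t) first≡1 p) ∘ cyc-inj H′
                                            , [ inj₁ ∘ cong (cyc H′) , inj₂ ∘ cong (cyc H′) ] ∘ adj⇒ o t })
                    (segment H′ first last′ (≤last first)) }
    where open Around H′ o o≡0

  arcs : ∀ {u v} → OnHoleWith F u v → u ≢ v → ¬ Adj F u v → Arcs u v
  arcs (H , u∈ , v∈) u≢v ¬uv with rotateTo H u∈
  ... | H′ , (o , o≡0 , refl) , to , _ with to v∈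
  ...   | j , refl = record
    { distinct = u≢v ; hole = H′ ; u∈ = o , refl ; v∈ = j , refl ; A = Low ; B = High
    ; arcA = lowArc ; arcB = highArc ; separated = separated′ }
    where
    open Around H′ o o≡0
    j≢o : j ≢ o
    j≢o refl = u≢v refl
    j≢first : j ≢ first
    j≢first refl = ¬uv adj-first
    j≢last : j ≢ last′
    j≢last refl = ¬uv adj-last
    open Between j j≢o j≢first j≢last

-- Vertices with the NC property

module _ {F : Graph N} where

  end∈ : ∀ {P x y} → Walk F P x y → P y
  end∈ w = start∈ (reverseʷ w)

  connect : ∀ {H u v A a b} → Arc {F = F} H u v A → A a → A b → Walk F A a b
  connect α a b = reverseʷ (Arc.reach α a) ++ʷ Arc.reach α b

  -- A bypass from one arc to the other around v would close up to a hole that avoids u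
  -- and runs through v along the same two edges.
  noBypass : ∀ {u v} → NCVertex F u → (R : Arcs {F = F} u v) → ∀ {T : Fin N → Set} {a b s t} →
             Arcs.A R a → Arcs.B R b → Touch F a s → Touch F b t → Walk F T s t →
             ¬ (∀ {c} → T c → c ≢ u × ¬ Touch F v c)
  noBypass {u} {v} nc R {T} a∈ b∈ as bt w away =
    closeUp {P = λ c → A c ⊎ B c ⊎ T c} α.far-adj β.far-adj (separated α.far∈ β.far∈) only
      (weaken inj₁ (connect arcA α.far∈ a∈) ++ʷ touchWalk (inj₁ a∈) (inj₂ (inj₂ (start∈ w))) as
       ++ʷ weaken (inj₂ ∘ inj₂) w ++ʷ touchWalk (inj₂ (inj₂ (end∈ w))) (inj₂ (inj₁ b∈)) (touch-sym {F = F} bt)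
       ++ʷ weaken (inj₂ ∘ inj₁) (connect arcB b∈ β.far∈))
      λ (K , v∈K , inside , w′) →
        let a∈K = proj₂ (start∈ w′) ; b∈K = proj₂ (end∈ w′) in
        nc hole K u∈ (λ u∈K → [ distinct , [ (λ p → α.u∉ p refl) , [ (λ p → β.u∉ p refl) , (λ p → proj₁ (away p) refl) ] ] ]
                              (inside u∈K))
           (α.far , v , β.far , (λ e → separated α.far∈ β.far∈ (inj₁ e))
           , adj⇒edge hole (α.on α.far∈) v∈ (adj-sym F α.far-adj) , adj⇒edge hole v∈ (β.on β.far∈) β.far-adj
           , adj⇒edge K a∈K v∈K (adj-sym F α.far-adj) , adj⇒edge K v∈K b∈K β.far-adj)
    where
    open Arcs R
    module α = Arc arcA
    module β = Arc arcB
    only : ∀ {c} → A c ⊎ B c ⊎ T c → c ≢ v × (Adj F v c → c ≡ α.far ⊎ c ≡ β.far)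
    only (inj₁ p) = α.v∉ p , inj₁ ∘ α.far-only p
    only (inj₂ (inj₁ p)) = β.v∉ p , inj₂ ∘ β.far-only p
    only (inj₂ (inj₂ p)) = (λ { refl → proj₂ (away p) (inj₁ refl) }) , λ e → ⊥-elim (proj₂ (away p) (inj₂ e))

  -- A connected set that reaches from `u` to `v` and in which `u` has the single neighbour `root`.
  -- It is `v` alone if `uv` is an edge, and an arc together with `v` if `uv` is a chord of a hole.
  record Tail (u v : Fin N) (S : Fin N → Set) : Set where
    field
      root     : Fin N
      root-adj : Adj F u root
      only     : ∀ {a} → S a → a ≢ u × (Adj F u a → a ≡ root)
      top∈     : S v
      reach    : ∀ {a} → S a → Walk F S root a

    walk : Walk F S root v
    walk = reach top∈

  singleTail : ∀ {u v} → Adj F u v → Tail u v (_≡ v)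
  singleTail e = record { root-adj = e ; top∈ = refl ; reach = λ { refl → stay refl }
                        ; only = λ { refl → (λ { refl → irrefl F _ e }) , (λ _ → refl) } }

  arcTail : ∀ {H u v A} → u ≢ v → ¬ Adj F u v → Arc {F = F} H u v A → Tail u v (λ a → A a ⊎ a ≡ v)
  arcTail u≢v ¬uv α = record
    { root-adj = near-adj
    ; only = λ { (inj₁ p) → u∉ p , near-only p ; (inj₂ refl) → u≢v ∘ sym , ⊥-elim ∘ ¬uv }
    ; top∈ = inj₂ refl
    ; reach = λ { (inj₁ p) → weaken inj₁ (reach p)
                ; (inj₂ refl) → weaken inj₁ (reach far∈) ++ʷ step (inj₁ far∈) (adj-sym F far-adj) (stay (inj₂ refl)) } }
    where open Arc α

  -- These are the vertices other than `u` that stay nonadjacent to `u` after local chordalization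
  -- by `u`.
  OffHoles : Fin N → Fin N → Set
  OffHoles u a = a ≢ u × ¬ Adj F u a × ¬ OnHoleWith F u a

  -- What a hole through `u` in the chordalized graph looks like once `u` is removed, with `y` and
  -- `z` the neighbours of `u` on it.
  Route : Fin N → Fin N → Fin N → Set
  Route u y z = Walk F (λ a → a ≡ y ⊎ a ≡ z ⊎ OffHoles u a) y z

  reverseRoute : ∀ {u y z} → Route u y z → Route u z y
  reverseRoute = reverseʷ ∘ weaken λ { (inj₁ e) → inj₂ (inj₁ e) ; (inj₂ (inj₁ e)) → inj₁ e ; (inj₂ (inj₂ o)) → inj₂ (inj₂ o) }

  -- Otherwise the tails and the route close up at u to a hole, which has to use a vertex of the route.
  tailsTouch : ∀ {u y z S T} → Tail u y S → Tail u z T → Route u y z →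
               ¬ (∀ s t → S s → T t → ¬ Touch F s t)
  tailsTouch {u} {y} {z} {S} {T} σ τ w ¬touch =
    closeUp {P = λ a → S a ⊎ T a ⊎ OffHoles u a} σ.root-adj τ.root-adj
      (¬touch _ _ (start∈ σ.walk) (start∈ τ.walk)) only
      (weaken inj₁ σ.walk ++ʷ weaken route w ++ʷ weaken (inj₂ ∘ inj₁) (reverseʷ τ.walk))
      λ (K , u∈K , _ , w′) →
        crossing (weaken (λ { (inj₁ p , _) → inj₁ p ; (inj₂ (inj₁ p) , _) → inj₂ p
                            ; (inj₂ (inj₂ (_ , _ , ¬h)) , a∈K) → ⊥-elim (¬h (K , u∈K , a∈K)) }) w′)
                 (start∈ σ.walk) (start∈ τ.walk) ¬touch
    where
    module σ = Tail σ
    module τ = Tail τ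
    only : ∀ {a} → S a ⊎ T a ⊎ OffHoles u a → a ≢ u × (Adj F u a → a ≡ σ.root ⊎ a ≡ τ.root)
    only (inj₁ p) = proj₁ (σ.only p) , inj₁ ∘ proj₂ (σ.only p)
    only (inj₂ (inj₁ p)) = proj₁ (τ.only p) , inj₂ ∘ proj₂ (τ.only p)
    only (inj₂ (inj₂ (≢u , ¬e , _))) = ≢u , ⊥-elim ∘ ¬e
    route : ∀ {a} → a ≡ y ⊎ a ≡ z ⊎ OffHoles u a → S a ⊎ T a ⊎ OffHoles u a
    route (inj₁ refl) = inj₁ (end∈ σ.walk)
    route (inj₂ (inj₁ refl)) = inj₂ (inj₁ (end∈ τ.walk))
    route (inj₂ (inj₂ o)) = inj₂ (inj₂ o)

  -- If `y` touched nothing in `T`, then by `tailsTouch` both arcs of the hole through `u` and `y`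
  -- would touch `T`. As `T` is connected and avoids `u`, it would be a bypass around `y`.
  tailTouchesEnd : ∀ {u y z T} → NCVertex F u → Arcs {F = F} u y → ¬ Adj F u y → Tail u z T → Route u y z →
                   ¬ (∀ t → T t → ¬ Touch F y t)
  tailTouchesEnd {u} {y} nc R ¬uy τ w ¬touch =
    tailsTouch (arcTail distinct ¬uy arcA) τ w λ where
      _ t (inj₂ refl) t∈ th → ¬touch t t∈ th
      _ t (inj₁ a∈) t∈ at → tailsTouch (arcTail distinct ¬uy arcB) τ w λ where
        _ t′ (inj₂ refl) t∈′ th → ¬touch t′ t∈′ th
        _ t′ (inj₁ b∈) t∈′ bt → noBypass nc R a∈ b∈ at bt
          (reverseʷ (Tail.reach τ t∈) ++ʷ Tail.reach τ t∈′) λ p → proj₁ (Tail.only τ p) , ¬touch _ p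
    where open Arcs R

  -- If `uy` or `uz` is an old edge, the tail on that side is a single vertex, and the touching
  -- lemmas make `y` touch `z`. If both are new chords, `y` touches each of the two arcs between `u`
  -- and `z`, so `y` alone is a bypass around `z`.
  noNewHole : ∀ {u y z} → NCVertex F u → u ≢ y → u ≢ z → (¬ Adj F u y → OnHoleWith F u y) →
              (¬ Adj F u z → OnHoleWith F u z) → ¬ Touch F y z → ¬ Route u y z
  noNewHole {u} {y} {z} nc u≢y u≢z hy hz ¬yz w = ¬¬-excluded-middle λ where
      (yes uy) → ¬¬-excluded-middle λ where
        (yes uz) → tailsTouch (singleTail uy) (singleTail uz) w λ { _ _ refl refl → ¬yz }
        (no ¬uz) → tailTouchesEnd nc (arcs (hz ¬uz) u≢z ¬uz) ¬uz (singleTail uy) (reverseRoute w)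
                     λ { _ refl → ¬yz ∘ touch-sym {F = F} }
      (no ¬uy) → ¬¬-excluded-middle λ where
        (yes uz) → tailTouchesEnd nc (arcs (hy ¬uy) u≢y ¬uy) ¬uy (singleTail uz) w λ { _ refl → ¬yz }
        (no ¬uz) → bothNew ¬uy ¬uz
    where
    module _ (¬uy : ¬ Adj F u y) (¬uz : ¬ Adj F u z) where
      R : Arcs u z
      R = arcs (hz ¬uz) u≢z ¬uz
      touchesArc : ∀ {H A} → Arc {F = F} H u z A → ¬ ¬ (∃[ a ] A a × Touch F a y)
      touchesArc α ¬t = tailTouchesEnd nc (arcs (hy ¬uy) u≢y ¬uy) ¬uy (arcTail u≢z ¬uz α) w λ where
        a (inj₁ a∈) ya → ¬t (a , a∈ , touch-sym {F = F} ya)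
        _ (inj₂ refl) → ¬yz
      bothNew : ⊥
      bothNew = touchesArc (Arcs.arcA R) λ (a , a∈ , ay) → touchesArc (Arcs.arcB R) λ (b , b∈ , by) →
        noBypass nc R {T = _≡ y} a∈ b∈ ay by (stay refl) λ { refl → u≢y ∘ sym , ¬yz ∘ touch-sym {F = F} }

  -- A vertex `t` touching both arcs would itself be a bypass around `v`.
  untouchedArc : ∀ {u v t} → NCVertex F u → Arcs {F = F} u v → t ≢ u → ¬ Touch F v t →
                 ¬ (∀ {A H} → Arc {F = F} H u v A → ¬ (∀ {a} → A a → ¬ Touch F a t))
  untouchedArc {t = t} nc R t≢u ¬vt κ =
    κ (Arcs.arcA R) λ a∈ at → κ (Arcs.arcB R) λ b∈ bt →
      noBypass nc R {T = _≡ t} a∈ b∈ at bt (stay refl) λ { refl → t≢u , ¬vt }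

  -- The hole runs from `u₁` to `v` along an arc that `u₂` does not touch, then from `v` to `u₂`
  -- along an arc that `u₁` does not touch, and returns by the edge `e`. The two arcs may meet each
  -- other, since `closeUp` shortens the walk.
  onCommonHole : ∀ {u₁ u₂ v} → NCVertex F u₁ → NCVertex F u₂ → Adj F u₁ u₂ →
                 u₁ ≢ v → u₂ ≢ v → ¬ Adj F u₁ v → ¬ Adj F u₂ v →
                 OnHoleWith F u₁ v → OnHoleWith F u₂ v → ¬ ¬ OnHoleWith F u₁ u₂
  onCommonHole {u₁} {u₂} {v} nc₁ nc₂ e u₁≢v u₂≢v ¬u₁v ¬u₂v h₁ h₂ κ =
    untouchedArc nc₁ (arcs h₁ u₁≢v ¬u₁v) u₂≢u₁ [ u₂≢v ∘ sym , ¬u₂v ∘ adj-sym F ] λ {A} α ¬Au₂ →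
    untouchedArc nc₂ (arcs h₂ u₂≢v ¬u₂v) (u₂≢u₁ ∘ sym) [ u₁≢v ∘ sym , ¬u₁v ∘ adj-sym F ] λ {C} γ ¬Cu₁ →
    closeUp {P = λ a → A a ⊎ a ≡ v ⊎ C a ⊎ a ≡ u₂} (Arc.near-adj α) e (¬Au₂ (Arc.near∈ α))
      (λ { (inj₁ p) → Arc.u∉ α p , inj₁ ∘ Arc.near-only α p
         ; (inj₂ (inj₁ refl)) → u₁≢v ∘ sym , ⊥-elim ∘ ¬u₁v
         ; (inj₂ (inj₂ (inj₁ p))) → ¬Cu₁ p ∘ inj₁ , ⊥-elim ∘ ¬Cu₁ p ∘ inj₂ ∘ adj-sym F
         ; (inj₂ (inj₂ (inj₂ refl))) → u₂≢u₁ , (λ _ → inj₂ refl) })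
      (weaken inj₁ (Arc.reach α (Arc.far∈ α))
       ++ʷ step (inj₁ (Arc.far∈ α)) (adj-sym F (Arc.far-adj α)) (step (inj₂ (inj₁ refl)) (Arc.far-adj γ)
           (weaken (inj₂ ∘ inj₂ ∘ inj₁) (reverseʷ (Arc.reach γ (Arc.far∈ γ)))
            ++ʷ step (inj₂ (inj₂ (inj₁ (Arc.near∈ γ)))) (adj-sym F (Arc.near-adj γ)) (stay (inj₂ (inj₂ (inj₂ refl)))))))
      λ (K , u₁∈ , _ , w) → κ (K , u₁∈ , proj₂ (end∈ w))
    where
    u₂≢u₁ : u₂ ≢ u₁
    u₂≢u₁ refl = irrefl F _ e

  squareHole : ∀ {a b c d} → Adj F a b → Adj F b c → Adj F c d → Adj F d a → a ≢ c → b ≢ d →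
               ¬ Adj F a c → ¬ Adj F b d → ¬ ¬ OnHoleWith F a b
  squareHole {a} {b} {c} {d} ab bc cd da a≢c b≢d ¬ac ¬bd κ =
    closeUp {P = λ x → x ≡ b ⊎ x ≡ c ⊎ x ≡ d} ab (adj-sym F da) [ b≢d , ¬bd ]
      (λ { (inj₁ refl) → (λ { refl → irrefl F _ ab }) , (λ _ → inj₁ refl)
         ; (inj₂ (inj₁ refl)) → a≢c ∘ sym , ⊥-elim ∘ ¬ac
         ; (inj₂ (inj₂ refl)) → (λ { refl → irrefl F _ da }) , (λ _ → inj₂ refl) })
      (step (inj₁ refl) bc (step (inj₂ (inj₁ refl)) cd (stay (inj₂ (inj₂ refl)))))
      λ (K , a∈ , _ , w) → κ (K , a∈ , proj₂ (start∈ w))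

  -- All new edges contain `u`, so the hole without `u` is a walk of `F`. Its inner vertices are not
  -- joined to `u` even after chordalizing, which makes it a `Route`.
  localStep-noHole : ∀ {u} → NCVertex F u → (K : Hole (localStep F true u)) → ¬ (u ∈H K)
  localStep-noHole {u} nc K u∈K = noNewHole nc (u≢ left-adj) (u≢ right-adj) (onHole left-adj) (onHole right-adj)
    (apart ∘ [ inj₁ , inj₂ ∘ inj₁ ])
    (mapʷ (λ {a} (_ , a≢u , only) → classify a a≢u only) (λ (_ , a≢u , _) (_ , b≢u , _) → old a≢u b≢u) walk)
    where
    F₁ = localStep F true u
    open Star (star K u∈K)
    u≢ : ∀ {a} → Adj F₁ u a → u ≢ a
    u≢ e refl = irrefl F₁ u e
    onHole : ∀ {a} → Adj F₁ u a → ¬ Adj F u a → OnHoleWith F u a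
    onHole (inj₁ e) ¬e = ⊥-elim (¬e e)
    onHole (inj₂ (_ , _ , inj₁ (_ , h))) _ = h
    onHole (inj₂ (_ , u≢a , inj₂ (refl , _))) _ = ⊥-elim (u≢a refl)
    old : ∀ {a b} → a ≢ u → b ≢ u → Adj F₁ a b → Adj F a b
    old a≢u b≢u (inj₁ e) = e
    old a≢u b≢u (inj₂ (_ , _ , inj₁ (e , _))) = ⊥-elim (a≢u e)
    old a≢u b≢u (inj₂ (_ , _ , inj₂ (e , _))) = ⊥-elim (b≢u e)
    classify : ∀ a → a ≢ u → (Adj F₁ u a → a ≡ left ⊎ a ≡ right) → a ≡ left ⊎ a ≡ right ⊎ OffHoles u a
    classify a a≢u only with a ≟F left | a ≟F right
    ... | yes e | _ = inj₁ e
    ... | no _ | yes e = inj₂ (inj₁ e)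
    ... | no ¬l | no ¬r = inj₂ (inj₂ (a≢u , ¬e ∘ inj₁ , λ h → ¬e (inj₂ (refl , a≢u ∘ sym , inj₁ (refl , h)))))
      where
      ¬e : ¬ Adj F₁ u a
      ¬e = [ ¬l , ¬r ] ∘ only

-- Vertices on holes under adding chords of holes

module _ {L : Graph N} {x : Fin N} (x∉Ω : ¬ InΩ L x) where

  -- If x had neighbours on both arcs, the first ones met from a would lie on a hole through x.
  detour : ∀ {a b} → OnHoleWith L a b → a ≢ b → ¬ Adj L a b → a ≢ x → b ≢ x → ¬ Adj L x a →
           ¬ ¬ Walk L (λ c → c ≢ x × (Adj L x c → c ≡ b)) a b
  detour {a} {b} h a≢b ¬ab a≢x b≢x ¬xa κ = ¬¬-excluded-middle {A = ∃[ c ] A c × Adj L x c} λ where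
      (no ¬c) → κ (through arcA ¬c)
      (yes (c , c∈ , xc)) → ¬¬-excluded-middle {A = ∃[ d ] B d × Adj L x d} λ where
        (no ¬d) → κ (through arcB ¬d)
        (yes (d , d∈ , xd)) →
          firstHit (Arc.reach arcA c∈) xc λ (c′ , c′∈ , xc′ , v) →
          firstHit (Arc.reach arcB d∈) xd λ (d′ , d′∈ , xd′ , w) →
          closeUp {P = λ e → e ≢ x × (Adj L x e → e ≡ c′ ⊎ e ≡ d′)} xc′ xd′ (separated c′∈ d′∈) id
            (reverseʷ (weaken (λ (p , f) → off arcA p , inj₁ ∘ f) v)
             ++ʷ step (off arcA (Arc.near∈ arcA) , inj₁ ∘ proj₂ (start∈ v)) (adj-sym L (Arc.near-adj arcA))
                 (step (a≢x , ⊥-elim ∘ ¬xa) (Arc.near-adj arcB)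
                   (weaken (λ (p , f) → off arcB p , inj₂ ∘ f) w)))
            λ (K , x∈K , _) → x∉Ω (K , x∈K)
    where
    R : Arcs a b
    R = arcs h a≢b ¬ab
    open Arcs R
    off : ∀ {A H c} → Arc {F = L} H a b A → A c → c ≢ x
    off {H = H} α p refl = x∉Ω (H , Arc.on α p)
    through : ∀ {A H} → Arc {F = L} H a b A → ¬ (∃[ c ] A c × Adj L x c) →
              Walk L (λ c → c ≢ x × (Adj L x c → c ≡ b)) a b
    through α ¬c =
      step (a≢x , ⊥-elim ∘ ¬xa) (Arc.near-adj α)
        (weaken (λ p → off α p , λ e → ⊥-elim (¬c (_ , p , e))) (Arc.reach α (Arc.far∈ α))
         ++ʷ step (off α (Arc.far∈ α) , λ e → ⊥-elim (¬c (_ , Arc.far∈ α , e))) (adj-sym L (Arc.far-adj α))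
             (stay (b≢x , λ _ → refl)))

-- If `x` were on no hole of `L`, all edges at `x` would be old. Replacing each chord on the hole
-- `K` by a detour in `L` then gives a walk between the neighbours of `x` that closes up in `L`.
InΩ-chords : ∀ {L L₁ : Graph N} → Supergraph L L₁ → (∀ {a b} → Adj L₁ a b → Adj L a b ⊎ OnHoleWith L a b) →
             ∀ {x} → InΩ L₁ x → ¬ ¬ InΩ L x
InΩ-chords {N} {L} {L₁} sub ext {x} (K , x∈K) x∉Ω =
  convert walk λ w → closeUp (old left-adj) (old right-adj) (apart ∘ [ inj₁ , inj₂ ∘ sub _ _ ]) id w
    λ (K , x∈ , _) → x∉Ω (K , x∈)
  where
  open Star (star K x∈K)
  P Q : Fin N → Set
  P a = a ∈H K × a ≢ x × (Adj L₁ x a → a ≡ left ⊎ a ≡ right)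
  Q a = a ≢ x × (Adj L x a → a ≡ left ⊎ a ≡ right)
  P⇒Q : ∀ {a} → P a → Q a
  P⇒Q (_ , a≢x , only) = a≢x , only ∘ sub _ _
  old : ∀ {a} → Adj L₁ x a → Adj L x a
  old e with ext e
  ... | inj₁ e′ = e′
  ... | inj₂ (H , x∈ , _) = ⊥-elim (x∉Ω (H , x∈))
  notBoth : ∀ {a b} → P a → P b → Adj L₁ a b → Adj L x a → ¬ Adj L x b
  notBoth pa pb e xa xb with proj₂ (P⇒Q pa) xa | proj₂ (P⇒Q pb) xb
  ... | inj₁ refl | inj₁ refl = irrefl L₁ _ e
  ... | inj₁ refl | inj₂ refl = apart (inj₂ e)
  ... | inj₂ refl | inj₁ refl = apart (inj₂ (adj-sym L₁ e))
  ... | inj₂ refl | inj₂ refl = irrefl L₁ _ e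
  link : ∀ {a b} → P a → P b → Adj L₁ a b → ¬ ¬ Walk L Q a b
  link {a} {b} pa@(_ , a≢x , _) pb@(_ , b≢x , _) e κ with ext e
  ... | inj₁ e′ = κ (step (P⇒Q pa) e′ (stay (P⇒Q pb)))
  ... | inj₂ h@(H , a∈ , b∈) = ¬¬-excluded-middle λ where
      (yes ab) → κ (step (P⇒Q pa) ab (stay (P⇒Q pb)))
      (no ¬ab) → ¬¬-excluded-middle λ where
        -- A detour must start at an end not adjacent to `x`. If `a` is adjacent to `x`, then `b` is
        -- not, because the neighbours of `x` on `K` are apart; the detour is then taken from `b`
        -- and reversed.
        (no ¬xa) → detour x∉Ω h a≢b ¬ab a≢x b≢x ¬xa (κ ∘ weaken λ (≢x , only) →
                     ≢x , λ xc → subst (λ v → v ≡ left ⊎ v ≡ right) (sym (only xc))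
                                   (proj₂ (P⇒Q pb) (subst (Adj L x) (only xc) xc)))
        (yes xa) → detour x∉Ω (H , b∈ , a∈) (a≢b ∘ sym) (¬ab ∘ adj-sym L) b≢x a≢x (notBoth pa pb e xa)
                     (κ ∘ reverseʷ ∘ weaken λ (≢x , only) →
                       ≢x , λ xc → subst (λ v → v ≡ left ⊎ v ≡ right) (sym (only xc)) (proj₂ (P⇒Q pa) xa))
    where
    a≢b : a ≢ b
    a≢b refl = irrefl L₁ _ e
  convert : ∀ {a b} → Walk L₁ P a b → ¬ ¬ Walk L Q a b
  convert (stay p) κ = κ (stay (P⇒Q p))
  convert (step p e w) κ = convert w λ w′ → link p (start∈ w) e λ v → κ (v ++ʷ w′)

-- Local chordalization by an NC set

mapHole : ∀ {F F′ : Graph N} (H : Hole F) →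
          (∀ {i j} → Adj F (cyc H i) (cyc H j) → Adj F′ (cyc H i) (cyc H j)) →
          (∀ {i j} → Adj F′ (cyc H i) (cyc H j) → Adj F (cyc H i) (cyc H j)) → Hole F′
mapHole H to from = record
  { len = len H ; len≥4 = len≥4 H ; cyc = cyc H ; cyc-inj = cyc-inj H
  ; induced = λ i j → proj₁ (induced H i j) ∘ from , to ∘ proj₂ (induced H i j) }

-- A hole that misses `u` contains no added edge, so the same cycle is a hole of `F`.
lowerHole : ∀ {F : Graph N} {b u} → (b ≡ true → NCVertex F u) → Hole (localStep F b u) → Hole F
lowerHole {F = F} {b} {u} nc K = mapHole K old inj₁
  where
  old : ∀ {i j} → Adj (localStep F b u) (cyc K i) (cyc K j) → Adj F (cyc K i) (cyc K j)
  old (inj₁ e) = e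
  old {i} (inj₂ (refl , _ , inj₁ (e , _))) = ⊥-elim (localStep-noHole (nc refl) K (i , e))
  old {j = j} (inj₂ (refl , _ , inj₂ (e , _))) = ⊥-elim (localStep-noHole (nc refl) K (j , e))

OnHoleWith-sym : ∀ {F : Graph N} {x y} → OnHoleWith F x y → OnHoleWith F y x
OnHoleWith-sym (H , x∈ , y∈) = H , y∈ , x∈

module _ (D : Fin N → Bool) where

  NewEdge : Graph N → Fin N → Fin N → Set
  NewEdge F x y = OnHoleWith F x y × (D x ≡ true ⊎ D y ≡ true)

  hat-super : ∀ xs {F : Graph N} → Supergraph F (foldl (λ H u → localStep H (D u) u) F xs)
  hat-super [] x y e = e
  hat-super (u ∷ xs) x y e = hat-super xs x y (inj₁ e)

  -- Holes after a step are holes before it, on the same vertices. Hence the NC property survives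
  -- each step, and every chord added later is a chord of a hole of the initial `F`.
  hat-edges : ∀ xs {F : Graph N} → (∀ u → D u ≡ true → NCVertex F u) → ∀ {x y} →
              Adj (foldl (λ H u → localStep H (D u) u) F xs) x y → Adj F x y ⊎ NewEdge F x y
  hat-edges [] nc e = inj₁ e
  hat-edges (u ∷ xs) {F} nc e
    with hat-edges xs (λ w Dw H₁ H₂ → nc w Dw (lowerHole (nc u) H₁) (lowerHole (nc u) H₂)) e
  ... | inj₁ (inj₁ e′) = inj₁ e′
  ... | inj₁ (inj₂ (Du , _ , inj₁ (refl , h))) = inj₂ (h , inj₁ Du)
  ... | inj₁ (inj₂ (Du , _ , inj₂ (refl , h))) = inj₂ (OnHoleWith-sym {F = F} h , inj₂ Du)
  ... | inj₂ ((K , x∈ , y∈) , d) = inj₂ ((lowerHole (nc u) K , x∈ , y∈) , d)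

¬¬-∀ : ∀ {s} {Q : Fin s → Set} → (∀ i → ¬ ¬ Q i) → ¬ ¬ (∀ i → Q i)
¬¬-∀ {zero} q κ = κ λ ()
¬¬-∀ {suc s} q κ = q zero λ q₀ → ¬¬-∀ (q ∘ suc) λ qs → κ λ { zero → q₀ ; (suc i) → qs i }

module _ {G F F′ : Graph N} {D : Fin N → Bool} (nc : NCSet F (λ v → D v ≡ true))
         (new : ∀ {x y} → Adj F′ x y → Adj F x y ⊎ NewEdge D F x y)
         (full : ∀ {x y} → InΩ F x → InΩ F y → Adj G x y → Adj F x y) where

  private
    -- Edges of `G` are included so that cliques can use vertices which `F` still leaves isolated.
    -- By `full`, `L` and `F` agree on the vertices lying on holes of `F`.
    L : Graph N
    L = union G F

  -- The pairs joined only by new edges form a star: two disjoint ones would put two vertices of D on one hole.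
  cliqueDrop : ∀ {P s} → HasCliqueIn (union G F′) P (suc s) → ¬ ¬ HasCliqueIn L P s
  cliqueDrop {P} {s} (f , f-inj , fP , fadj) κ = ¬¬-excluded-middle {A = ∃[ i ] ∃[ j ] Bad i j} λ where
      -- Without new edges any vertex may be dropped; otherwise it is the end in `D` of some new
      -- edge, the centre of the star.
      (no none) → drop zero λ i j _ _ i≢j ¬e → none (split i≢j ¬e)
      (yes (i₀ , _ , b₀)) → drop i₀ λ i j i≢ j≢ i≢j ¬e → second b₀ i≢ j≢ i≢j ¬e
    where
    Bad : Fin (suc s) → Fin (suc s) → Set
    Bad i j = i ≢ j × D (f i) ≡ true × ¬ Adj L (f i) (f j)
    classify : ∀ {i j} → i ≢ j → Adj L (f i) (f j) ⊎ NewEdge D F (f i) (f j)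
    classify {i} {j} i≢j with fadj i j i≢j
    ... | inj₁ e = inj₁ (inj₁ e)
    ... | inj₂ e with new e
    ...   | inj₁ e′ = inj₁ (inj₂ e′)
    ...   | inj₂ h = inj₂ h
    onHole : ∀ {i j} → i ≢ j → ¬ Adj L (f i) (f j) → OnHoleWith F (f i) (f j)
    onHole i≢j ¬e with classify i≢j
    ... | inj₁ e = ⊥-elim (¬e e)
    ... | inj₂ (h , _) = h
    split : ∀ {i j} → i ≢ j → ¬ Adj L (f i) (f j) → ∃[ i ] ∃[ j ] Bad i j
    split i≢j ¬e with classify i≢j
    ... | inj₁ e = ⊥-elim (¬e e)
    ... | inj₂ (_ , inj₁ d) = _ , _ , i≢j , d , ¬e
    ... | inj₂ (_ , inj₂ d) = _ , _ , i≢j ∘ sym , d , ¬e ∘ adj-sym L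
    drop : ∀ i₀ → (∀ i j → i ≢ i₀ → j ≢ i₀ → i ≢ j → ¬ ¬ Adj L (f i) (f j)) → ⊥
    drop i₀ e = ¬¬-∀ (λ i → ¬¬-∀ λ j κ′ → ¬¬-excluded-middle {A = i ≡ j} λ where
                       (yes i≡j) → κ′ λ i≢j → ⊥-elim (i≢j i≡j)
                       (no i≢j) → e _ _ (punchInᵢ≢i i₀ i) (punchInᵢ≢i i₀ j) (i≢j ∘ punchIn-injective i₀ i j)
                                    λ a → κ′ λ _ → a)
                λ adj → κ (f ∘ punchIn i₀ , punchIn-injective i₀ _ _ ∘ f-inj , fP ∘ punchIn i₀ , adj)
    disjoint : ∀ {i j} → D (f i) ≡ true → D (f j) ≡ true → i ≢ j → ¬ OnHoleWith F (f i) (f j)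
    disjoint di dj i≢j (H , i∈ , j∈) = i≢j (f-inj (proj₂ nc H _ _ di dj i∈ j∈))
    module _ {i₁ j₁ i₂ j₂} (b₁ : Bad i₁ j₁) (b₂ : Bad i₂ j₂) (i₁≢i₂ : i₁ ≢ i₂) (i₁≢j₂ : i₁ ≢ j₂) where
      D₁ = proj₁ (proj₂ b₁)
      D₂ = proj₁ (proj₂ b₂)
      h₁ : OnHoleWith F (f i₁) (f j₁)
      h₁ = onHole (proj₁ b₁) (proj₂ (proj₂ b₁))
      h₂ : OnHoleWith F (f i₂) (f j₂)
      h₂ = onHole (proj₁ b₂) (proj₂ (proj₂ b₂))
      ω : ∀ {x y} → OnHoleWith F x y → InΩ F x
      ω (H , x∈ , _) = H , x∈
      ω′ : ∀ {x y} → OnHoleWith F x y → InΩ F y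
      ω′ (H , _ , y∈) = H , y∈
      ¬D₁ : D (f j₁) ≢ true
      ¬D₁ d = disjoint D₁ d (proj₁ b₁) h₁
      ¬D₂ : D (f j₂) ≢ true
      ¬D₂ d = disjoint D₂ d (proj₁ b₂) h₂
      i₂≢j₁ : i₂ ≢ j₁
      i₂≢j₁ refl = ¬D₁ D₂
      inF : ∀ {x y} → InΩ F x → InΩ F y → Adj L x y → Adj F x y
      inF x∈ y∈ = [ full x∈ y∈ , id ]
      tips : Adj F (f i₁) (f i₂)
      tips with classify i₁≢i₂
      ... | inj₁ e = inF (ω h₁) (ω h₂) e
      ... | inj₂ (h , _) = ⊥-elim (disjoint D₁ D₂ i₁≢i₂ h)
      bases : j₁ ≢ j₂ → Adj F (f j₁) (f j₂)
      bases j₁≢j₂ with classify j₁≢j₂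
      ... | inj₁ e = inF (ω′ h₁) (ω′ h₂) e
      ... | inj₂ (_ , d) = ⊥-elim ([ ¬D₁ , ¬D₂ ] d)
      inF⁻ : ∀ {x y} → InΩ F x → InΩ F y → ¬ Adj F x y → ¬ Adj L x y
      inF⁻ x∈ y∈ ¬e = ¬e ∘ inF x∈ y∈
      common : ∀ {j} → i₁ ≢ j → i₂ ≢ j → InΩ F (f j) → ¬ Adj F (f i₁) (f j) → ¬ Adj F (f i₂) (f j) → ⊥
      common i₁≢j i₂≢j j∈ ¬e₁ ¬e₂ =
        onCommonHole (proj₁ nc _ D₁) (proj₁ nc _ D₂) tips (i₁≢j ∘ f-inj) (i₂≢j ∘ f-inj) ¬e₁ ¬e₂
          (onHole i₁≢j (inF⁻ (ω h₁) j∈ ¬e₁)) (onHole i₂≢j (inF⁻ (ω h₂) j∈ ¬e₂))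
          (disjoint D₁ D₂ i₁≢i₂)
      ¬e₁ : ¬ Adj F (f i₁) (f j₁)
      ¬e₁ = proj₂ (proj₂ b₁) ∘ inj₂
      ¬e₂ : ¬ Adj F (f i₂) (f j₂)
      ¬e₂ = proj₂ (proj₂ b₂) ∘ inj₂
      -- If `f i₁` and `f j₂` are nonadjacent, both tips have a chord to `f j₂`, and `onCommonHole`
      -- applies; likewise for `f i₂` and `f j₁`. If both cross pairs are edges, the four vertices
      -- form an induced square through both tips. The case `j₁ ≡ j₂` is included, and it falls
      -- under the first alternative.
      noMatching : ⊥
      noMatching = ¬¬-excluded-middle λ where
        (no ¬a) → common i₁≢j₂ (proj₁ b₂) (ω′ h₂) ¬a ¬e₂
        (yes a) → ¬¬-excluded-middle λ where
          (no ¬b) → common (proj₁ b₁) i₂≢j₁ (ω′ h₁) ¬e₁ ¬b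
          (yes b) → squareHole tips b (bases λ { refl → ¬e₁ a }) (adj-sym F a)
                      (proj₁ b₁ ∘ f-inj) (proj₁ b₂ ∘ f-inj) ¬e₁ ¬e₂ (disjoint D₁ D₂ i₁≢i₂)
    second : ∀ {i₀ j₀ i j} → Bad i₀ j₀ → i ≢ i₀ → j ≢ i₀ → i ≢ j → ¬ ¬ Adj L (f i) (f j)
    second b₀ i≢ j≢ i≢j ¬e with classify i≢j
    ... | inj₁ e = ¬e e
    ... | inj₂ (_ , inj₁ d) = noMatching b₀ (i≢j , d , ¬e) (i≢ ∘ sym) (j≢ ∘ sym)
    ... | inj₂ (_ , inj₂ d) = noMatching b₀ (i≢j ∘ sym , d , ¬e ∘ adj-sym L) (j≢ ∘ sym) (i≢ ∘ sym)

-- Local chordalization partitions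

InΩ⇒adj : ∀ {F : Graph N} {x} → InΩ F x → ∃ (Adj F x)
InΩ⇒adj (H , x∈) = _ , Star.left-adj (star H x∈)

mapClique : ∀ (F F′ : Graph N) P {s t} → Supergraph F F′ → t ≤ s → HasCliqueIn F P s → HasCliqueIn F′ P t
mapClique F F′ P sub t≤s (f , f-inj , fP , adj) =
  (λ i → f (inject≤ i t≤s)) , inject≤-injective t≤s t≤s _ _ ∘ f-inj , (λ i → fP (inject≤ i t≤s))
  , λ i j i≢j → sub _ _ (adj _ _ (i≢j ∘ inject≤-injective t≤s t≤s i j))

lastIndex : Fin k → ∃[ l ] suc (toℕ {k} l) ≡ k
lastIndex {suc k} _ = fromℕ k , cong suc (toℕ-fromℕ k)

module _ {N k : ℕ} (G : Graph N) (p : Fin N → Maybe (Fin k)) (isLCP : LCP.IsLCP G p) where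
  open LCP G p

  active-suc : ∀ {i v} → Active i v → Active (suc i) v
  active-suc (inj₁ e) = inj₁ e
  active-suc (inj₂ (t , e , t<i)) = inj₂ (t , e , ≤-trans t<i (n≤1+n _))

  active-k : ∀ v → Active k v
  active-k v with p v
  ... | nothing = inj₁ refl
  ... | just t = inj₂ (t , refl , toℕ<n t)

  memb⇒ : ∀ i v → memb i v ≡ true → ∃[ t ] p v ≡ just t × toℕ t ≡ i
  memb⇒ i v m with p v
  ... | just t with toℕ t ≟ℕ i
  ...   | yes e = t , refl , e

  memb-NC : ∀ {i} → i < k → NCSet (Gi (suc i)) (λ v → memb i v ≡ true)
  memb-NC i<k = subst (λ i → NCSet (Gi (suc i)) (λ v → memb i v ≡ true)) (toℕ-fromℕ< i<k) (at (fromℕ< i<k))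
    where
    at : ∀ t → NCSet (Gi (suc (toℕ t))) (λ v → memb (toℕ t) v ≡ true)
    at t with proj₁ (proj₂ (proj₂ isLCP t))
    ... | nc , one = (λ u m → nc u (part u m)) , λ H a b ma mb → one H a b (part a ma) (part b mb)
      where
      part : ∀ v → memb (toℕ t) v ≡ true → p v ≡ just t
      part v m with memb⇒ (toℕ t) v m
      ... | t′ , e , t′≡t = trans e (cong just (toℕ-injective t′≡t))

  Gstar-edges : ∀ {i} → i < k → ∀ {x y} → Adj (Gstar (suc i)) x y →
                Adj (Gi (suc i)) x y ⊎ NewEdge (memb i) (Gi (suc i)) x y
  Gstar-edges {i} i<k = hat-edges (memb i) (allFin N) (proj₁ (memb-NC i<k))

  Gstar-active : ∀ i → i ≤ k → ∀ {x y} → Adj (Gstar i) x y → Active i x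
  Gi-active : ∀ i → i < k → ∀ {x y} → Adj (Gi (suc i)) x y → Active (suc i) x
  Gi-active i i<k (inj₁ e) = active-suc (Gstar-active i (<⇒≤ i<k) e)
  Gi-active i i<k (inj₂ (ax , _)) = ax
  Gstar-active zero _ (ax , _) = ax
  Gstar-active (suc i) i<k e with Gstar-edges i<k e
  ... | inj₁ e′ = Gi-active i i<k e′
  ... | inj₂ ((H , x∈ , _) , _) = Gi-active i i<k (proj₂ (InΩ⇒adj (H , x∈)))

  Gstar-full : ∀ i {x y} → Active i x → Active i y → Adj G x y → Adj (Gstar i) x y
  Gstar-full zero ax ay e = ax , ay , e
  Gstar-full (suc i) ax ay e = hat-super (memb i) (allFin N) _ _ (inj₂ (ax , ay , e))

  Gstar-super : Supergraph G (Gstar k)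
  Gstar-super x y = Gstar-full k (active-k x) (active-k y)

  -- Inserting the next part only brings in edges of `G`, so cliques and holes change only in the
  -- chordalization.
  Gi⇒G∪Gstar : ∀ i {x y} → Adj (union G (Gi (suc i))) x y → Adj (union G (Gstar i)) x y
  Gi⇒G∪Gstar i (inj₁ e) = inj₁ e
  Gi⇒G∪Gstar i (inj₂ (inj₁ e)) = inj₂ e
  Gi⇒G∪Gstar i (inj₂ (inj₂ (_ , _ , e))) = inj₁ e

  -- A vertex on a hole has a neighbour and is therefore active, and `Gi` has all edges of `G`
  -- between active vertices. So a hole of `Gi` stays induced when the rest of `G` is added.
  Gi-full : ∀ {i} → i < k → ∀ {x y} → InΩ (Gi (suc i)) x → InΩ (Gi (suc i)) y → Adj G x y → Adj (Gi (suc i)) x y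
  Gi-full i<k x∈ y∈ e =
    inj₂ (Gi-active _ i<k (proj₂ (InΩ⇒adj x∈)) , Gi-active _ i<k (proj₂ (InΩ⇒adj y∈)) , e)

  OnHoleWith-Gi : ∀ {i} → i < k → ∀ {x y} → OnHoleWith (Gi (suc i)) x y → OnHoleWith (union G (Gi (suc i))) x y
  OnHoleWith-Gi i<k (H , x∈ , y∈) =
    mapHole H inj₂ (λ {s} {t} → [ Gi-full i<k (H , s , refl) (H , t , refl) , id ]) , x∈ , y∈

  Ω-Gi : ∀ i {x} → InΩ (union G (Gi (suc i))) x → InΩ (union G (Gstar i)) x
  Ω-Gi i (H , x∈) = mapHole H (Gi⇒G∪Gstar i) [ inj₁ , inj₂ ∘ inj₁ ] , x∈

  -- Each step adds chords of holes only, so `InΩ-chords` leads back one step at a time to `G`.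
  Ω-Gstar : ∀ i → i ≤ k → ∀ {x} → InΩ (union G (Gstar i)) x → ¬ ¬ InΩ G x
  Ω-Gstar zero _ (H , x∈) κ = κ (mapHole H [ id , proj₂ ∘ proj₂ ] inj₁ , x∈)
  Ω-Gstar (suc i) i<k x∈ κ =
    InΩ-chords (λ _ _ → [ inj₁ , inj₂ ∘ hat-super (memb i) (allFin N) _ _ ]) ext x∈
      λ x∈′ → Ω-Gstar i (<⇒≤ i<k) (Ω-Gi i x∈′) κ
    where
    ext : ∀ {a b} → Adj (union G (Gstar (suc i))) a b →
          Adj (union G (Gi (suc i))) a b ⊎ OnHoleWith (union G (Gi (suc i))) a b
    ext (inj₁ e) = inj₁ (inj₁ e)
    ext (inj₂ e) with Gstar-edges i<k e
    ... | inj₁ e′ = inj₁ (inj₂ e′)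
    ... | inj₂ (h , _) = inj₂ (OnHoleWith-Gi i<k h)

  Gstar-newEdge : ∀ i → i ≤ k → ∀ {x y} → Adj (Gstar i) x y → Adj G x y ⊎ (¬ ¬ InΩ G x × ¬ ¬ InΩ G y)
  Gstar-newEdge zero _ (_ , _ , e) = inj₁ e
  Gstar-newEdge (suc i) i<k e with Gstar-edges i<k e
  ... | inj₁ (inj₁ e′) = Gstar-newEdge i (<⇒≤ i<k) e′
  ... | inj₁ (inj₂ (_ , _ , e′)) = inj₁ e′
  ... | inj₂ (h , _) with OnHoleWith-Gi i<k h
  ...   | H , x∈ , y∈ = inj₂ (Ω-Gstar i (<⇒≤ i<k) (Ω-Gi i (H , x∈)) , Ω-Gstar i (<⇒≤ i<k) (Ω-Gi i (H , y∈)))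

  -- Undoing one step costs one vertex by `cliqueDrop`, which accounts for the summand `i`.
  Gstar-clique : ∀ i → i ≤ k → ∀ P {s} → HasCliqueIn (union G (Gstar i)) P (i + s) → ¬ ¬ HasCliqueIn G P s
  Gstar-clique zero _ P c κ = κ (mapClique (union G (Gstar 0)) G P (λ _ _ → [ id , proj₂ ∘ proj₂ ]) ≤-refl c)
  Gstar-clique (suc i) i<k P c κ =
    cliqueDrop {G = G} {F′ = Gstar (suc i)} (memb-NC i<k) (Gstar-edges i<k) (Gi-full i<k) {P = P} c λ c′ →
      Gstar-clique i (<⇒≤ i<k) P
        (mapClique (union G (Gi (suc i))) (union G (Gstar i)) P (λ _ _ → Gi⇒G∪Gstar i) ≤-refl c′) κ

  Gstar-chordal : Chordal (Gstar k)
  -- Chordality is given only after a step, so `k` must be positive: the hole cover is nonempty, and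
  -- any of its vertices lies in some part.
  Gstar-chordal with lastIndex (proj₁ (proj₂ (proj₁ (proj₁ isLCP))))
  ... | l , e = subst (Chordal ∘ Gstar) e (proj₂ (proj₂ (proj₂ isLCP l)))

-- Splitting a large clique by membership in Ω(G), and the final count

splitAt-injective : ∀ a b {x y : Fin (a + b)} → splitAt a x ≡ splitAt a y → x ≡ y
splitAt-injective a b {x} {y} e =
  trans (sym (join-splitAt a b x)) (trans (cong (join a b) e) (join-splitAt a b y))

copair-injective : ∀ {A : Set} {a b} {f : Fin a → A} {g : Fin b → A} →
                   Injective _≡_ _≡_ f → Injective _≡_ _≡_ g → (∀ i j → f i ≢ g j) →
                   Injective _≡_ _≡_ ([ f , g ] ∘ splitAt a)
copair-injective {a = a} {b} f-inj g-inj f≢g {x} {y} e with splitAt a x in ex | splitAt a y in ey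
... | inj₁ i | inj₂ j = ⊥-elim (f≢g i j e)
... | inj₂ i | inj₁ j = ⊥-elim (f≢g j i (sym e))
... | inj₁ i | inj₁ j = splitAt-injective a b (trans ex (trans (cong inj₁ (f-inj e)) (sym ey)))
... | inj₂ i | inj₂ j = splitAt-injective a b (trans ex (trans (cong inj₂ (g-inj e)) (sym ey)))

Selection : ∀ {s} → (Fin s → Set) → ℕ → Set
Selection {s} Q a = Σ[ f ∈ (Fin a → Fin s) ] Injective _≡_ _≡_ f × (∀ i → Q (f i))

selectZero : ∀ {s a} (Q : Fin (suc s) → Set) → Q zero → Selection (Q ∘ suc) a → Selection Q (suc a)
selectZero Q q (f , f-inj , fQ) = (λ { zero → zero ; (suc i) → suc (f i) })
  , (λ { {zero} {zero} _ → refl ; {suc i} {suc j} e → cong suc (f-inj (Fin-suc-injective e)) })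
  , λ { zero → q ; (suc i) → fQ i }

selectSuc : ∀ {s a} (Q : Fin (suc s) → Set) → Selection (Q ∘ suc) a → Selection Q a
selectSuc Q (f , f-inj , fQ) = suc ∘ f , f-inj ∘ Fin-suc-injective , fQ

separate : ∀ {s} {Q : Fin s → Set} → (∀ i → Dec (Q i)) →
           ∃[ a ] ∃[ b ] a + b ≡ s × Selection Q a × Selection (¬_ ∘ Q) b
separate {zero} _ = 0 , 0 , refl , ((λ ()) , (λ { {()} }) , λ ()) , ((λ ()) , (λ { {()} }) , λ ())
separate {suc s} {Q} Q? with Q? zero | separate (Q? ∘ suc)
... | yes q | a , b , e , σ , τ = suc a , b , cong suc e , selectZero Q q σ , selectSuc (¬_ ∘ Q) τ
... | no ¬q | a , b , e , σ , τ = a , suc b , trans (+-suc a b) (cong suc e) , selectSuc Q σ , selectZero (¬_ ∘ Q) ¬q τ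

-- The first `n` clique vertices outside `Q` serve as the complete side, and the `c` others outside
-- `Q` together with the `a` inside supply the edgeless side. Every required edge has an end outside
-- `Q`, so it is old.
joinSubgraph : ∀ {N s m n a c} {G G* : Graph N} {Q : Fin N → Set} →
               (∀ {x y} → ¬ Q x → Adj G* x y → Adj G x y) →
               (clique : HasClique G* s) → Selection (Q ∘ proj₁ clique) a → Selection (¬_ ∘ Q ∘ proj₁ clique) (n + c) →
               m ≤ c + a → ContainsSubgraph (Join (Edgeless m) (Complete n)) G
joinSubgraph {s = s} {m} {n} {a} {c} {G} {Q = Q} old (f , f-inj , _ , adj) (g , g-inj , gQ) (h , h-inj , ¬hQ) m≤c+a =
  f ∘ place , place-inj ∘ f-inj , λ i j → edges (splitAt m i) (splitAt m j)
  where
  others : Fin (c + a) → Fin s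
  others = [ h ∘ (n ↑ʳ_) , g ] ∘ splitAt c
  core : Fin n → Fin s
  core j = h (j ↑ˡ c)
  others-inj : Injective _≡_ _≡_ others
  others-inj = copair-injective (↑ʳ-injective n _ _ ∘ h-inj) g-inj λ i j e → ¬hQ _ (subst (Q ∘ f) (sym e) (gQ j))
  others≢core : ∀ i j → others i ≢ core j
  others≢core i j e with splitAt c i
  ... | inj₂ i′ = ¬hQ _ (subst (Q ∘ f) e (gQ i′))
  ... | inj₁ i′ with () ← trans (sym (splitAt-↑ʳ n c i′)) (trans (cong (splitAt n) (h-inj e)) (splitAt-↑ˡ n j c))
  slot : Fin m ⊎ Fin n → Fin s
  slot = [ (λ i → others (inject≤ i m≤c+a)) , core ]
  place : Fin (m + n) → Fin s
  place = [ (λ i → others (inject≤ i m≤c+a)) , core ] ∘ splitAt m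
  place-inj : Injective _≡_ _≡_ place
  place-inj = copair-injective (inject≤-injective m≤c+a m≤c+a _ _ ∘ others-inj)
    (↑ˡ-injective c _ _ ∘ h-inj) λ i j → others≢core (inject≤ i m≤c+a) j
  edges : ∀ x y → JAdj (Edgeless m) (Complete n) x y → Adj G (f (slot x)) (f (slot y))
  edges (inj₂ i) (inj₂ j) i≢j = old (¬hQ _) (adj _ _ (i≢j ∘ ↑ˡ-injective c i j ∘ h-inj))
  edges (inj₂ i) (inj₁ j) _ = old (¬hQ _) (adj _ _ (others≢core _ i ∘ sym))
  edges (inj₁ i) (inj₂ j) _ = adj-sym G (old (¬hQ _) (adj _ _ (others≢core _ j ∘ sym)))

theorem4p17 : (m n : ℕ) → 1 ≤ n → n ≤ m → {N : ℕ} (G : Graph N) →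
    ¬ Chordal G →
    ¬ ContainsSubgraph (Join (Edgeless m) (Complete n)) G →
    (∃[ w ] ∃[ k ] (IsCliqueNumberOn G (InΩ G) w × IsNonChordalityIndex G k × w + k ≤ m)) →
    Σ[ G* ∈ Graph N ] (Supergraph G G* × Chordal G* × (∀ s → HasClique G* s → s < m + n))
theorem4p17 m n _ _ G ¬chordal noJoin (w , k , _ , inj₁ (chordal , _) , _) = ⊥-elim (¬chordal chordal)
theorem4p17 m n _ _ G ¬chordal noJoin (w , k , (_ , w-max) , inj₂ (_ , (p , isLCP) , _) , w+k≤m) =
  Gstar k , Gstar-super G p isLCP , Gstar-chordal G p isLCP , λ s c → ≰⇒> (large c)
  where
  open LCP G p using (Gstar)
  old : ∀ {x y} → ¬ InΩ G x → Adj (Gstar k) x y → Adj G x y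
  old x∉ e with Gstar-newEdge G p isLCP k ≤-refl e
  ... | inj₁ e′ = e′
  ... | inj₂ (x∈ , _) = ⊥-elim (x∈ x∉)
  large : ∀ {s} → HasClique (Gstar k) s → ¬ (m + n ≤ s)
  -- The goal is a negation, so membership in Ω(G) may be decided for all of the finitely many
  -- clique vertices at once.
  large {s} c@(f , f-inj , _ , adj) m+n≤s = ¬¬-∀ (λ i → ¬¬-excluded-middle) count
    where
    few : ∀ a d → a + (n + d) ≡ s → m ≤ d + a
    few a d e = +-cancelʳ-≤ n m (d + a)
      (subst (m + n ≤_) (trans (sym e) (trans (cong (a +_) (+-comm n d))
        (trans (sym (+-assoc a d n)) (cong (_+ n) (+-comm a d))))) m+n≤s)
    -- From `b < n` follows `suc m ≤ a`, and `k + suc w` is at most `suc m`; after `k` steps `suc w`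
    -- vertices are left, one more than the clique number on Ω(G).
    many : ∀ a b → a + b ≡ s → b < n → k + suc w ≤ a
    many a b e b<n = subst (_≤ a) (trans (cong suc (+-comm w k)) (sym (+-suc k w)))
      (≤-trans (s≤s w+k≤m) (+-cancelʳ-≤ b (suc m) a
        (subst₂ _≤_ (+-suc m b) (sym e) (≤-trans (+-monoʳ-≤ m b<n) m+n≤s))))
    count : ¬ (∀ i → Dec (InΩ G (f i)))
    count Ω? with separate Ω?
    ... | a , b , e , (g , g-inj , gΩ) , τ with b <? n
    ...   | yes b<n = Gstar-clique G p isLCP k ≤-refl (InΩ G)
            (mapClique (Gstar k) (union G (Gstar k)) (InΩ G) (λ _ _ → inj₂) (many a b e b<n)
              (f ∘ g , g-inj ∘ f-inj , gΩ , λ i j i≢j → adj _ _ (i≢j ∘ g-inj)))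
            λ c′ → <-irrefl refl (w-max (suc w) c′)
    ...   | no b≮n with m≤n⇒∃[o]m+o≡n (≮⇒≥ b≮n)
    ...     | d , refl = noJoin (joinSubgraph {n = n} {c = d} {G = G} {G* = Gstar k} {Q = InΩ G} old c (g , g-inj , gΩ) τ (few a d e))
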